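{- Let $k\ge 3$ be a fixed integer. Let $f^{mon}_{\mathcal{S}_{k,k}}(n)$ denote the monotone threshold bias of the $(1:b)$ Avoider-Enforcer game on $E(K_n)$ in which Avoider loses iff his graph contains a copy of the double star $\mathcal{S}_{k,k}$, and let $f^{mon}_{\mathcal{PS}_{k,k}}(n)$ denote the monotone threshold bias of the analogous game for the path double star $\mathcal{PS}_{k,k}$. Then, as $n\to\infty$, (i) $f^{mon}_{\mathcal{S}_{k,k}}=\Theta(n^{\frac{k}{k-1}})$; (ii) $f^{mon}_{\mathcal{PS}_{k,k}}=\Theta(n^{\frac{k+1}{k}})$.
   Context: The double star $\mathcal{S}_{k,k}$ is the graph on $2k$ vertices $u,u_1,\dots,u_{k-1},v,v_1,\dots,v_{k-1}$ with edge set $\{uv\}\cup\{uu_i:1\le i\le k-1\}\cup\{vv_i:1\le i\le k-1\}$. The path double star $\mathcal{PS}_{k,k}$ is the graph on $2k+1$ vertices $w,u,u_1,\dots,u_{k-1},v,v_1,\dots,v_{k-1}$ with edge set $\{uu_i:1\le i\le k-1\}\cup\{vv_i:1\le i\le k-1\}\cup\{vw,uw\}$. For a fixed graph $H$, the monotone $(1:b)$ $H$-game on $E(K_n)$: Avoider and Enforcer alternately claim previously unclaimed edges of $K_n$, Avoider first; Avoider claims at least $1$ and Enforcer at least $b$ unclaimed edges per move (if fewer remain than required, the player claims all remaining ones); the game ends when all edges are claimed, and Avoider loses iff his claimed edges contain (the edge set of) a copy of $H$. The monotone threshold bias is the largest non-negative integer $f$ such that Enforcer wins this monotone $(1:b)$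 game if and only if $b\le f$. -}

module Defs where

open import Data.Nat using (ℕ; zero; suc; _+_; _*_; _∸_; _≤_; _<_; _<?_)
open import Data.Fin using (Fin; toℕ)
open import Data.List using (List; []; _∷_; _++_; map; length; upTo; allFin; filter; cartesianProduct)
open import Data.List.Membership.Propositional using (_∈_)
open import Data.Product using (_×_; _,_; proj₁; proj₂; Σ)
open import Data.Sum using (_⊎_)
open import Relation.Binary.PropositionalEquality using (_≡_)
open import Function.Bundles using (_⇔_)

-- A fixed (pattern) graph: vertex set {0,…,m-1}, given by its edge list.
record Graph : Set where
  constructor mkGraph
  field
    verts : ℕ
    edges : List (ℕ × ℕ)

open Graph public

-- An edge of K_n is stored as an ordered pair (i , j) with i < j.
Edge : ℕ → Set
Edge n = Fin n × Fin n

edgesK : (n : ℕ) → List (Edge n)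
edgesK n = filter (λ p → toℕ (proj₁ p) <? toℕ (proj₂ p))
                  (cartesianProduct (allFin n) (allFin n))

HasEdge : ∀ {n} → List (Edge n) → Fin n → Fin n → Set
HasEdge A x y = ((x , y) ∈ A) ⊎ ((y , x) ∈ A)

ContainsCopy : (H : Graph) → ∀ {n} → List (Edge n) → Set
ContainsCopy H {n} A =
  Σ (ℕ → Fin n) λ φ →
    (∀ x y → x < verts H → y < verts H → φ x ≡ φ y → x ≡ y) ×
    (∀ {a b} → (a , b) ∈ edges H → HasEdge A (φ a) (φ b))

data Split {A : Set} : List A → List A → List A → Set where
  []  : Split [] [] []
  inS : ∀ {x F S R} → Split F S R → Split (x ∷ F) (x ∷ S) R
  inR : ∀ {x F S R} → Split F S R → Split (x ∷ F) S (x ∷ R)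

-- Monotone (1:b) Avoider–Enforcer H-game on E(K_n), Avoider first.
-- State: F = list of unclaimed edges, A = Avoider's edges.
-- EnfWinsA b F A : Enforcer has a winning strategy when it is Avoider's turn.
-- EnfWinsE b F A : Enforcer has a winning strategy when it is Enforcer's turn.
-- (Inductive = finite game tree, so this is exactly existence of a winning
-- strategy for Enforcer.)
module _ (H : Graph) {n : ℕ} (b : ℕ) where
  mutual
    data EnfWinsA : List (Edge n) → List (Edge n) → Set where
      endA  : ∀ {A} → ContainsCopy H A → EnfWinsA [] A
      moveA : ∀ {e F A} →
              (∀ {S R} → Split (e ∷ F) S R → 1 ≤ length S → EnfWinsE R (S ++ A)) →
              EnfWinsA (e ∷ F) A

    data EnfWinsE : List (Edge n) → List (Edge n) → Set where
      endE  : ∀ {A} → ContainsCopy H A → EnfWinsE [] A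
      moveE : ∀ {e F A S R} → Split (e ∷ F) S R →
              (b ≤ length S ⊎ R ≡ []) →
              EnfWinsA R A →
              EnfWinsE (e ∷ F) A

EnforcerWins : Graph → ℕ → ℕ → Set
EnforcerWins H n b = EnfWinsA H {n} b (edgesK n) []

IsMonThreshold : Graph → ℕ → ℕ → Set
IsMonThreshold H n t = ∀ b → EnforcerWins H n b ⇔ (b ≤ t)

-- Double star S_{k,k}: u = 0, v = 1, u_i = 1+i (i=1..k-1), v_i = k+i.
doubleStar : ℕ → Graph
doubleStar k = mkGraph (2 * k)
  ((0 , 1) ∷ map (λ i → (0 , 2 + i)) (upTo (k ∸ 1))
           ++ map (λ i → (1 , suc k + i)) (upTo (k ∸ 1)))

-- Path double star PS_{k,k}: as above plus w = 2k, edges uw, vw (no uv).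
pathDoubleStar : ℕ → Graph
pathDoubleStar k = mkGraph (suc (2 * k))
  ((0 , 2 * k) ∷ (1 , 2 * k) ∷ map (λ i → (0 , 2 + i)) (upTo (k ∸ 1))
           ++ map (λ i → (1 , suc k + i)) (upTo (k ∸ 1)))

{-# OPTIONS --safe #-}
-- Both upper bounds come from one Avoider strategy: always claim a single free edge whose larger
-- endpoint degree is minimal.  If V_j is the number of vertices of degree at least j, then V_j can
-- only become positive once every free edge meets V_{j-1}, i.e. once at most 2n·V_{j-1} edges are
-- free, and afterwards b·V_j + 2|F| never increases.  Hence b^j·V_j ≤ 4^j·n^{j+1}, and if
-- b^m > 4^m·n^{m+1} all degrees are below m before each Avoider move.  One more edge creates
-- neither S_{m+1,m+1} nor PS_{m,m}.
--
-- For the lower bounds Enforcer maintains a set of active vertices and always claims exactly the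
-- free edges that meet no active vertex, so every Avoider edge raises the degree of an active
-- vertex.  To have b edges to claim he deactivates D = b/h active vertices of lowest degree
-- (h = n/4).  Giving a vertex of degree d the weight (D+1)^min(d,m), the degree raised by Avoider
-- pays for the deactivated vertices, so the total weight stays at least a constant times (D+1)^m,
-- and boundedly many (but enough) vertices reach degree m.  Among these there are two with
-- disjoint m-stars, one of which, u, was active until now, so that all its edges are free or
-- Avoider's; leaving a single suitable edge at u free completes the copy.
module Submission where

open import Defs
open import Data.Nat
open import Data.Nat.Properties
open import Data.Nat.DivMod using (_/_; _%_; m≡m%n+[m/n]*n; m%n<n; m/n*n≤m; m*n/n≡m; /-monoˡ-≤)
open import Data.Nat.ListAction using (sum)
open import Data.Nat.ListAction.Properties using (sum-++)
open import Data.Nat.Solver using (module +-*-Solver)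
open import Data.Fin using (Fin; toℕ)
import Data.Fin.Properties as Fin
open import Data.List using (List; []; _∷_; _++_; map; length; take; drop; filter; upTo; allFin; concatMap; cartesianProduct)
open import Data.List.Properties using (length-++; length-take; length-map; length-tabulate; length-upTo; take++drop≡id; map-++; ++-identityʳ)
open import Data.List.Membership.Propositional using (_∈_; _∉_; lose)
open import Data.List.Membership.Propositional.Properties
import Data.List.Membership.DecPropositional as DecMembership
open import Data.List.Relation.Unary.Any using (here; there)
open import Data.List.Relation.Unary.All as All using ()
open import Data.List.Relation.Unary.AllPairs using ([]; _∷_)
open import Data.List.Relation.Unary.Unique.Propositional using (Unique)
import Data.List.Relation.Unary.Unique.Propositional.Properties as Unique
open import Data.List.Relation.Binary.Subset.Propositional using (_⊆_)
open import Data.Product using (_×_; _,_; proj₁; proj₂; ∃)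
open import Data.Product.Properties using (≡-dec)
open import Data.Sum using (_⊎_; inj₁; inj₂)
open import Data.Empty using (⊥; ⊥-elim)
open import Relation.Nullary using (¬_; Dec; yes; no; ¬?)
open import Relation.Nullary.Decidable using (map′; _×-dec_; _⊎-dec_; _→-dec_)
open import Relation.Unary using (Decidable)
open import Relation.Binary.Definitions using (DecidableEquality; tri<; tri≈; tri>)
open import Relation.Binary.PropositionalEquality
open import Function using (_∘_; id)
open import Function.Bundles using (mk⇔; Equivalence)

-- Lists and degrees

-- Each entry of `xs` removes its own occurrence from `ys`, and distinctness keeps the later entries
-- inside what is left. Most counting of vertices and edges below rests on this pigeonhole bound.
length-⊆ : ∀ {A : Set} {xs ys : List A} → Unique xs → xs ⊆ ys → length xs ≤ length ys
length-⊆ {xs = []} _ _ = z≤n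
length-⊆ {xs = x ∷ xs} (x∉ ∷ u) sub with ∈-∃++ (sub (here refl))
... | ys₁ , ys₂ , refl = begin
    suc (length xs)               ≤⟨ s≤s (length-⊆ u sub′) ⟩
    suc (length (ys₁ ++ ys₂))     ≡⟨ cong suc (length-++ ys₁) ⟩
    suc (length ys₁ + length ys₂) ≡⟨ sym (+-suc _ _) ⟩
    length ys₁ + suc (length ys₂) ≡⟨ sym (length-++ ys₁) ⟩
    length (ys₁ ++ x ∷ ys₂)       ∎
  where
  open ≤-Reasoning
  sub′ : xs ⊆ ys₁ ++ ys₂
  sub′ z∈ with ∈-++⁻ ys₁ (sub (there z∈))
  ... | inj₁ p = ∈-++⁺ˡ p
  ... | inj₂ (here refl) = ⊥-elim (All.lookup x∉ z∈ refl)
  ... | inj₂ (there p) = ∈-++⁺ʳ ys₁ p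

∷-unique : ∀ {A : Set} {x : A} {xs} → x ∉ xs → Unique xs → Unique (x ∷ xs)
∷-unique x∉ u = All.tabulate (λ y∈ x≡y → x∉ (subst (_∈ _) (sym x≡y) y∈)) ∷ u

unique-head : ∀ {A : Set} {x : A} {xs} → Unique (x ∷ xs) → x ∉ xs
unique-head (x∉ ∷ _) x∈ = All.lookup x∉ x∈ refl

unique-++⁻ʳ : ∀ {A : Set} (xs : List A) {ys} → Unique (xs ++ ys) → Unique ys
unique-++⁻ʳ [] u = u
unique-++⁻ʳ (x ∷ xs) (_ ∷ u) = unique-++⁻ʳ xs u

unique-++⁻ˡ : ∀ {A : Set} (xs : List A) {ys} → Unique (xs ++ ys) → Unique xs
unique-++⁻ˡ [] u = []
unique-++⁻ˡ (x ∷ xs) u@(_ ∷ u′) =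
  ∷-unique (λ x∈ → unique-head u (∈-++⁺ˡ x∈)) (unique-++⁻ˡ xs u′)

unique-++-disjoint : ∀ {A : Set} (xs : List A) {ys} {z : A} → Unique (xs ++ ys) → z ∈ xs → z ∉ ys
unique-++-disjoint (x ∷ xs) u (here refl) z∈ys = unique-head u (∈-++⁺ʳ xs z∈ys)
unique-++-disjoint (x ∷ xs) (_ ∷ u) (there z∈) = unique-++-disjoint xs u z∈

unique-++⁺ : ∀ {A : Set} {xs ys : List A} → Unique xs → Unique ys →
             (∀ {z} → z ∈ xs → z ∉ ys) → Unique (xs ++ ys)
unique-++⁺ u v d = Unique.++⁺ u v (λ (p , q) → d p q)

module Avoiding {A : Set} (_≟ᴬ_ : DecidableEquality A) where
  open DecMembership _≟ᴬ_ using (_∉?_)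

  record Selection (xs ys : List A) (j : ℕ) : Set where
    field
      chosen   : List A
      unique   : Unique chosen
      size     : length chosen ≡ j
      inside   : chosen ⊆ xs
      outside  : ∀ {z} → z ∈ chosen → z ∉ ys

  -- At most `length ys` entries of `xs` are forbidden, so at least `j` survive. Leaves of stars are
  -- chosen this way, with `ys` the vertices to be avoided.
  select : ∀ {xs} ys j → Unique xs → length ys + j ≤ length xs → Selection xs ys j
  select {xs} ys j u le = record
    { chosen  = take j rest
    ; unique  = Unique.take⁺ j (Unique.filter⁺ (_∉? ys) u)
    ; size    = trans (length-take j rest) (m≤n⇒m⊓n≡m j≤rest)
    ; inside  = proj₁ ∘ ∈-filter⁻ (_∉? ys) ∘ in-rest
    ; outside = proj₂ ∘ ∈-filter⁻ (_∉? ys) {xs = xs} ∘ in-rest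
    }
    where
    rest = filter (_∉? ys) xs
    in-rest : take j rest ⊆ rest
    in-rest z∈ = subst (_ ∈_) (take++drop≡id j rest) (∈-++⁺ˡ z∈)
    cover : xs ⊆ ys ++ rest
    cover {z} z∈ with DecMembership._∈?_ _≟ᴬ_ z ys
    ... | yes p = ∈-++⁺ˡ p
    ... | no ¬p = ∈-++⁺ʳ ys (∈-filter⁺ (_∉? ys) z∈ ¬p)
    j≤rest : j ≤ length rest
    j≤rest = +-cancelˡ-≤ (length ys) j (length rest)
      (≤-trans le (≤-trans (length-⊆ u cover) (≤-reflexive (length-++ ys))))

  fresh : ∀ {xs} ys → Unique xs → length ys < length xs → ∃ λ z → z ∈ xs × z ∉ ys
  fresh ys u lt with select ys 1 u (≤-trans (≤-reflexive (+-comm (length ys) 1)) lt)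
  ... | record { chosen = z ∷ [] ; inside = i ; outside = o } = z , i (here refl) , o (here refl)

-- Sums over lists

Σ[_] : ∀ {A : Set} → (A → ℕ) → List A → ℕ
Σ[ f ] xs = sum (map f xs)

Σ-mono : ∀ {A : Set} {f g : A → ℕ} xs → (∀ {x} → x ∈ xs → f x ≤ g x) → Σ[ f ] xs ≤ Σ[ g ] xs
Σ-mono [] h = z≤n
Σ-mono (x ∷ xs) h = +-mono-≤ (h (here refl)) (Σ-mono xs (h ∘ there))

Σ-const : ∀ {A : Set} c (xs : List A) → Σ[ (λ _ → c) ] xs ≡ length xs * c
Σ-const c [] = refl
Σ-const c (x ∷ xs) = cong (c +_) (Σ-const c xs)

Σ-upper : ∀ {A : Set} {f : A → ℕ} {c} xs → (∀ {x} → x ∈ xs → f x ≤ c) → Σ[ f ] xs ≤ length xs * c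
Σ-upper {c = c} xs h = ≤-trans (Σ-mono xs h) (≤-reflexive (Σ-const c xs))

Σ-lower : ∀ {A : Set} {f : A → ℕ} {c} xs → (∀ {x} → x ∈ xs → c ≤ f x) → length xs * c ≤ Σ[ f ] xs
Σ-lower {c = c} xs h = ≤-trans (≤-reflexive (sym (Σ-const c xs))) (Σ-mono xs h)

Σ-bump : ∀ {A : Set} {f g : A → ℕ} {c y} xs → (∀ {x} → x ∈ xs → f x ≤ g x) →
         y ∈ xs → f y + c ≤ g y → Σ[ f ] xs + c ≤ Σ[ g ] xs
Σ-bump {f = f} {g} {c} (x ∷ xs) h (here refl) le = begin
    f x + Σ[ f ] xs + c   ≡⟨ +-assoc (f x) _ c ⟩
    f x + (Σ[ f ] xs + c) ≡⟨ cong (f x +_) (+-comm _ c) ⟩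
    f x + (c + Σ[ f ] xs) ≡⟨ sym (+-assoc (f x) c _) ⟩
    f x + c + Σ[ f ] xs   ≤⟨ +-mono-≤ le (Σ-mono xs (h ∘ there)) ⟩
    g x + Σ[ g ] xs       ∎
  where open ≤-Reasoning
Σ-bump {f = f} {g} {c} (x ∷ xs) h (there y∈) le =
  ≤-trans (≤-reflexive (+-assoc (f x) _ c)) (+-mono-≤ (h (here refl)) (Σ-bump xs (h ∘ there) y∈ le))

Σ-++ : ∀ {A : Set} (f : A → ℕ) xs ys → Σ[ f ] (xs ++ ys) ≡ Σ[ f ] xs + Σ[ f ] ys
Σ-++ f xs ys = trans (cong sum (map-++ f xs ys)) (sum-++ (map f xs) (map f ys))

Σ-+ : ∀ {A : Set} (f g : A → ℕ) xs → Σ[ (λ x → f x + g x) ] xs ≡ Σ[ f ] xs + Σ[ g ] xs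
Σ-+ f g [] = refl
Σ-+ f g (x ∷ xs) = trans (cong (f x + g x +_) (Σ-+ f g xs)) (solve 4 (λ a b c d → a :+ b :+ (c :+ d) := a :+ c :+ (b :+ d)) refl (f x) (g x) (Σ[ f ] xs) (Σ[ g ] xs))
  where open +-*-Solver

Σ-filter : ∀ {A : Set} (f : A → ℕ) {P : A → Set} (P? : Decidable P) xs →
           Σ[ f ] xs ≡ Σ[ f ] (filter P? xs) + Σ[ f ] (filter (¬? ∘ P?) xs)
Σ-filter f P? [] = refl
Σ-filter f P? (x ∷ xs) with P? x
... | yes _ = trans (cong (f x +_) (Σ-filter f P? xs)) (sym (+-assoc (f x) _ _))
... | no _  = trans (cong (f x +_) (Σ-filter f P? xs)) (trans (sym (+-assoc (f x) a b)) (trans (cong (_+ b) (+-comm (f x) a)) (+-assoc a (f x) b)))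
  where a = Σ[ f ] (filter P? xs)
        b = Σ[ f ] (filter (¬? ∘ P?) xs)

Σ-1 : ∀ {A : Set} (xs : List A) → Σ[ (λ _ → 1) ] xs ≡ length xs
Σ-1 xs = trans (Σ-const 1 xs) (*-identityʳ _)

Σ-* : ∀ {A : Set} c (f : A → ℕ) xs → Σ[ (λ x → c * f x) ] xs ≡ c * Σ[ f ] xs
Σ-* c f [] = sym (*-zeroʳ c)
Σ-* c f (x ∷ xs) = trans (cong (c * f x +_) (Σ-* c f xs)) (sym (*-distribˡ-+ c (f x) _))

length-filter-¬ : ∀ {A : Set} {P : A → Set} (P? : Decidable P) xs →
                  length xs ≡ length (filter P? xs) + length (filter (¬? ∘ P?) xs)
length-filter-¬ P? xs = trans (sym (Σ-1 xs)) (trans (Σ-filter (λ _ → 1) P? xs)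
  (cong₂ _+_ (Σ-1 (filter P? xs)) (Σ-1 (filter (¬? ∘ P?) xs))))

length-concatMap : ∀ {A B : Set} (f : A → List B) xs → length (concatMap f xs) ≡ Σ[ length ∘ f ] xs
length-concatMap f [] = refl
length-concatMap f (x ∷ xs) = trans (length-++ (f x)) (cong (length (f x) +_) (length-concatMap f xs))

-- Neighbourhoods and degrees

module _ {n : ℕ} where
  open Avoiding (Fin._≟_ {n}) public

  _≟ᴱ_ : DecidableEquality (Edge n)
  _≟ᴱ_ = ≡-dec Fin._≟_ Fin._≟_

  open DecMembership _≟ᴱ_ using (_∈?_)

  abstract
    hasEdge? : ∀ (L : List (Edge n)) x y → Dec (HasEdge L x y)
    hasEdge? L x y = ((x , y) ∈? L) ⊎-dec ((y , x) ∈? L)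

  hasEdge-sym : ∀ {L : List (Edge n)} {x y} → HasEdge L x y → HasEdge L y x
  hasEdge-sym (inj₁ p) = inj₂ p
  hasEdge-sym (inj₂ p) = inj₁ p

  hasEdge-mono : ∀ {L M : List (Edge n)} {x y} → L ⊆ M → HasEdge L x y → HasEdge M x y
  hasEdge-mono sub (inj₁ p) = inj₁ (sub p)
  hasEdge-mono sub (inj₂ p) = inj₂ (sub p)

  -- `Edge n` admits pairs `(x , x)`, so loops are excluded here; a star chosen among the neighbours
  -- of a vertex then never contains its centre.
  Adjacent : List (Edge n) → Fin n → Fin n → Set
  Adjacent L x y = y ≢ x × HasEdge L x y

  adjacent? : ∀ L x y → Dec (Adjacent L x y)
  adjacent? L x y = ¬? (y Fin.≟ x) ×-dec hasEdge? L x y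

  -- Filtering `allFin n` instead of reading off the edge list makes the neighbours distinct, so
  -- repeated or reversed edges count once in `deg`.
  nbrs : List (Edge n) → Fin n → List (Fin n)
  nbrs L x = filter (adjacent? L x) (allFin n)

  deg : List (Edge n) → Fin n → ℕ
  deg L x = length (nbrs L x)

  ∈-nbrs⁺ : ∀ {L x y} → y ≢ x → HasEdge L x y → y ∈ nbrs L x
  ∈-nbrs⁺ {L} {x} {y} y≢x e = ∈-filter⁺ (adjacent? L x) (∈-allFin y) (y≢x , e)

  ∈-nbrs⁻ : ∀ {L x y} → y ∈ nbrs L x → y ≢ x × HasEdge L x y
  ∈-nbrs⁻ {L} {x} y∈ = proj₂ (∈-filter⁻ (adjacent? L x) {xs = allFin n} y∈)

  nbrs-sym : ∀ {L x y} → y ∈ nbrs L x → x ∈ nbrs L y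
  nbrs-sym {L} y∈ with ∈-nbrs⁻ {L} y∈
  ... | y≢x , e = ∈-nbrs⁺ {L} (y≢x ∘ sym) (hasEdge-sym {L} e)

  nbrs-unique : ∀ L x → Unique (nbrs L x)
  nbrs-unique L x = Unique.filter⁺ (adjacent? L x) (Unique.allFin⁺ n)

  nbrs-mono : ∀ {L M} x → L ⊆ M → nbrs L x ⊆ nbrs M x
  nbrs-mono {L} {M} x sub y∈ with ∈-nbrs⁻ {L} y∈
  ... | y≢x , e = ∈-nbrs⁺ {M} y≢x (hasEdge-mono {L} sub e)

  deg-mono : ∀ {L M} x → L ⊆ M → deg L x ≤ deg M x
  deg-mono {L} {M} x sub = length-⊆ (nbrs-unique L x) (nbrs-mono {L} {M} x sub)

  deg-lower : ∀ {L x ys} → Unique ys → (∀ {y} → y ∈ ys → y ≢ x × HasEdge L x y) → length ys ≤ deg L x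
  deg-lower {L} {x} u h = length-⊆ u (λ y∈ → ∈-nbrs⁺ {L} (proj₁ (h y∈)) (proj₂ (h y∈)))

  deg-[] : ∀ x → deg [] x ≡ 0
  deg-[] x = n≤0⇒n≡0 (length-⊆ {ys = []} (nbrs-unique [] x) λ y∈ → ⊥-elim (no-edge (proj₂ (∈-nbrs⁻ {L = []} y∈))))
    where no-edge : ∀ {y} → ¬ HasEdge [] x y
          no-edge (inj₁ ())
          no-edge (inj₂ ())

  length-allFin : length (allFin n) ≡ n
  length-allFin = length-tabulate id

  Incident : Edge n → Fin n → Set
  Incident (a , b) x = x ≡ a ⊎ x ≡ b

  incident? : ∀ e x → Dec (Incident e x)
  incident? (a , b) x = (x Fin.≟ a) ⊎-dec (x Fin.≟ b)

  hasEdge-∷⁻ : ∀ {L e x y} → ¬ Incident e x → HasEdge (e ∷ L) x y → HasEdge L x y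
  hasEdge-∷⁻ ni (inj₁ (here refl)) = ⊥-elim (ni (inj₁ refl))
  hasEdge-∷⁻ ni (inj₁ (there p)) = inj₁ p
  hasEdge-∷⁻ ni (inj₂ (here refl)) = ⊥-elim (ni (inj₂ refl))
  hasEdge-∷⁻ ni (inj₂ (there p)) = inj₂ p

  deg-∷-other : ∀ {L e x} → ¬ Incident e x → deg (e ∷ L) x ≤ deg L x
  deg-∷-other {L} {e} {x} ni = deg-lower {L} (nbrs-unique (e ∷ L) x) (λ y∈ →
    let (y≢x , h) = ∈-nbrs⁻ {e ∷ L} y∈ in y≢x , hasEdge-∷⁻ ni h)

  deg-∷-suc : ∀ L e x → deg (e ∷ L) x ≤ suc (deg L x)
  deg-∷-suc L (a , b) x with x Fin.≟ a
  ... | yes refl = length-⊆ (nbrs-unique ((a , b) ∷ L) a) sub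
    where
    sub : nbrs ((a , b) ∷ L) a ⊆ b ∷ nbrs L a
    sub y∈ with ∈-nbrs⁻ {(a , b) ∷ L} y∈
    ... | y≢ , inj₁ (here refl) = here refl
    ... | y≢ , inj₁ (there p) = there (∈-nbrs⁺ {L} y≢ (inj₁ p))
    ... | y≢ , inj₂ (here refl) = here refl
    ... | y≢ , inj₂ (there p) = there (∈-nbrs⁺ {L} y≢ (inj₂ p))
  ... | no x≢a = length-⊆ (nbrs-unique ((a , b) ∷ L) x) sub
    where
    sub : nbrs ((a , b) ∷ L) x ⊆ a ∷ nbrs L x
    sub y∈ with ∈-nbrs⁻ {(a , b) ∷ L} y∈
    ... | y≢ , inj₁ (here refl) = ⊥-elim (x≢a refl)
    ... | y≢ , inj₁ (there p) = there (∈-nbrs⁺ {L} y≢ (inj₁ p))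
    ... | y≢ , inj₂ (here refl) = here refl
    ... | y≢ , inj₂ (there p) = there (∈-nbrs⁺ {L} y≢ (inj₂ p))

-- Avoider's strategy

module _ {A : Set} where

  split-left : ∀ {F S R : List A} → Split F S R → S ⊆ F
  split-left (inS s) (here refl) = here refl
  split-left (inS s) (there p) = there (split-left s p)
  split-left (inR s) p = there (split-left s p)

  split-right : ∀ {F S R : List A} → Split F S R → R ⊆ F
  split-right (inS s) p = there (split-right s p)
  split-right (inR s) (here refl) = here refl
  split-right (inR s) (there p) = there (split-right s p)

  split-cover : ∀ {F S R : List A} {x} → Split F S R → x ∈ F → x ∈ S ⊎ x ∈ R
  split-cover (inS s) (here refl) = inj₁ (here refl)
  split-cover (inS s) (there p) with split-cover s p
  ... | inj₁ q = inj₁ (there q)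
  ... | inj₂ q = inj₂ q
  split-cover (inR s) (here refl) = inj₂ (here refl)
  split-cover (inR s) (there p) with split-cover s p
  ... | inj₁ q = inj₁ q
  ... | inj₂ q = inj₂ (there q)

  split-length : ∀ {F S R : List A} → Split F S R → length S + length R ≡ length F
  split-length [] = refl
  split-length (inS s) = cong suc (split-length s)
  split-length (inR s) = trans (+-suc _ _) (cong suc (split-length s))

  split-unique : ∀ {F S R : List A} → Split F S R → Unique F → Unique R
  split-unique [] u = u
  split-unique (inS s) (_ ∷ u) = split-unique s u
  split-unique (inR s) u@(_ ∷ u′) = ∷-unique (unique-head u ∘ split-right s) (split-unique s u′)

  split-disjoint : ∀ {F S R : List A} {x} → Split F S R → Unique F → x ∈ R → x ∉ S
  split-disjoint (inS s) u p (here refl) = unique-head u (split-right s p)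
  split-disjoint (inS s) (_ ∷ u) p (there q) = split-disjoint s u p q
  split-disjoint (inR s) u (here refl) q = unique-head u (split-left s q)
  split-disjoint (inR s) (_ ∷ u) (there p) q = split-disjoint s u p q

  split-all : ∀ (F : List A) → Split F F []
  split-all [] = []
  split-all (x ∷ F) = inS (split-all F)

  split-none : ∀ (F : List A) → Split F [] F
  split-none [] = []
  split-none (x ∷ F) = inR (split-none F)

  split-filter : ∀ {P : A → Set} (P? : Decidable P) F → Split F (filter (¬? ∘ P?) F) (filter P? F)
  split-filter P? [] = []
  split-filter P? (x ∷ F) with P? x
  ... | yes _ = inR (split-filter P? F)
  ... | no _  = inS (split-filter P? F)

  split-take : ∀ {F : List A} {x} → x ∈ F → ∃ λ R → Split F (x ∷ []) R
  split-take {x ∷ F} (here refl) = F , inS (split-none F)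
  split-take {y ∷ F} (there p) with split-take p
  ... | R , s = y ∷ R , inR s

  split-swap : ∀ {F S R : List A} → Split F S R → Split F R S
  split-swap [] = []
  split-swap (inS s) = inR (split-swap s)
  split-swap (inR s) = inS (split-swap s)

length-cartesianProduct : ∀ {A B : Set} (xs : List A) (ys : List B) →
                          length (cartesianProduct xs ys) ≡ length xs * length ys
length-cartesianProduct [] ys = refl
length-cartesianProduct (x ∷ xs) ys =
  trans (length-++ (map (x ,_) ys)) (cong₂ _+_ (length-map (x ,_) ys) (length-cartesianProduct xs ys))

module _ {n : ℕ} where

  heavy : List (Edge n) → ℕ → List (Fin n)
  heavy A j = filter (λ x → j ≤? deg A x) (allFin n)

  ∈-heavy⁺ : ∀ {A j x} → j ≤ deg A x → x ∈ heavy A j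
  ∈-heavy⁺ {A} {j} {x} le = ∈-filter⁺ (λ x → j ≤? deg A x) (∈-allFin x) le

  ∈-heavy⁻ : ∀ {A j x} → x ∈ heavy A j → j ≤ deg A x
  ∈-heavy⁻ {A} {j} x∈ = proj₂ (∈-filter⁻ (λ x → j ≤? deg A x) {xs = allFin n} x∈)

  heavy-unique : ∀ A j → Unique (heavy A j)
  heavy-unique A j = Unique.filter⁺ (λ x → j ≤? deg A x) (Unique.allFin⁺ n)

  length-heavy-∷ : ∀ A e j → length (heavy (e ∷ A) j) ≤ 2 + length (heavy A j)
  length-heavy-∷ A e@(a , c) j = length-⊆ (heavy-unique (e ∷ A) j) sub
    where
    sub : heavy (e ∷ A) j ⊆ a ∷ c ∷ heavy A j
    sub {x} x∈ with incident? e x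
    ... | yes (inj₁ refl) = here refl
    ... | yes (inj₂ refl) = there (here refl)
    ... | no ni = there (there (∈-heavy⁺ {A} (≤-trans (∈-heavy⁻ {e ∷ A} x∈) (deg-∷-other {L = A} ni))))

  rank : List (Edge n) → Edge n → ℕ
  rank A (a , c) = deg A a ⊔ deg A c

  minimal-rank : ∀ A e (F : List (Edge n)) → ∃ λ e₀ → e₀ ∈ e ∷ F × (∀ {f} → f ∈ e ∷ F → rank A e₀ ≤ rank A f)
  minimal-rank A e [] = e , here refl , λ { (here refl) → ≤-refl }
  minimal-rank A e (f ∷ F) with minimal-rank A f F
  ... | e₀ , e₀∈ , min with ≤-total (rank A e) (rank A e₀)
  ... | inj₁ le = e , here refl , λ { (here refl) → ≤-refl ; (there p) → ≤-trans le (min p) }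
  ... | inj₂ le = e₀ , there e₀∈ , λ { (here refl) → le ; (there p) → min p }

  rank≤⇒incident-heavy : ∀ {A j} {e : Edge n} → j ≤ rank A e → proj₁ e ∈ heavy A j ⊎ proj₂ e ∈ heavy A j
  rank≤⇒incident-heavy {A} {j} {a , c} le with ⊔-sel (deg A a) (deg A c)
  ... | inj₁ eq = inj₁ (∈-heavy⁺ {A} (subst (j ≤_) eq le))
  ... | inj₂ eq = inj₂ (∈-heavy⁺ {A} (subst (j ≤_) eq le))

  length-covered : ∀ {F : List (Edge n)} V → Unique F → (∀ {e} → e ∈ F → proj₁ e ∈ V ⊎ proj₂ e ∈ V) →
                   length F ≤ 2 * (n * length V)
  length-covered {F} V u cov = begin
      length F                                          ≤⟨ length-⊆ u sub ⟩
      length (C₁ ++ C₂)                                 ≡⟨ length-++ C₁ ⟩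
      length C₁ + length C₂                             ≡⟨ cong₂ _+_ (length-cartesianProduct V (allFin n)) (length-cartesianProduct (allFin n) V) ⟩
      length V * length (allFin n) + length (allFin n) * length V
                                                        ≡⟨ cong (λ p → length V * p + p * length V) length-allFin ⟩
      length V * n + n * length V                       ≡⟨ solve 2 (λ v n → v :* n :+ n :* v := con 2 :* (n :* v)) refl (length V) n ⟩
      2 * (n * length V)                                ∎
    where
    open ≤-Reasoning
    open +-*-Solver
    C₁ = cartesianProduct V (allFin n)
    C₂ = cartesianProduct (allFin n) V
    sub : F ⊆ C₁ ++ C₂
    sub {a , c} e∈ with cov e∈
    ... | inj₁ p = ∈-++⁺ˡ (∈-cartesianProduct⁺ p (∈-allFin c))
    ... | inj₂ p = ∈-++⁺ʳ C₁ (∈-cartesianProduct⁺ (∈-allFin a) p)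

  containsCopy-mono : ∀ H {A B : List (Edge n)} → A ⊆ B → ContainsCopy H A → ContainsCopy H B
  containsCopy-mono H {A} sub (φ , inj , pres) = φ , inj , λ p → hasEdge-mono {L = A} sub (pres p)

  module Avoider (b : ℕ) where

    -- When `heavy A (suc i)` first becomes non-empty, the sum in parentheses is at most `4 * n`
    -- times the size of `heavy A i` just before that move, and later it never grows. Inserting the
    -- bound on `heavy A i` gives the right-hand side; the factor `b ^ i` replaces a division.
    Bounded : List (Edge n) → List (Edge n) → ℕ → Set
    Bounded F A i = length (heavy A (suc i)) ≡ 0 ⊎
      b ^ i * (b * length (heavy A (suc i)) + 2 * length F) ≤ 4 ^ suc i * n ^ suc (suc i)

    record Sparse (F A : List (Edge n)) : Set where
      field
        unique  : Unique F
        bounded : ∀ i → Bounded F A i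

    open Sparse

    heavy-bound : ∀ {F A} → Sparse F A → ∀ j → b ^ j * length (heavy A j) ≤ 4 ^ j * n ^ suc j
    heavy-bound {F} {A} sp zero = begin
        1 * length (heavy A 0)  ≡⟨ *-identityˡ _ ⟩
        length (heavy A 0)      ≤⟨ length-⊆ (heavy-unique A 0) (λ {x} _ → ∈-allFin x) ⟩
        length (allFin n)       ≡⟨ length-allFin ⟩
        n                       ≡⟨ sym (trans (*-identityˡ _) (*-identityʳ n)) ⟩
        1 * (n * 1)             ∎
      where open ≤-Reasoning
    heavy-bound {F} {A} sp (suc i) with bounded sp i
    ... | inj₁ eq rewrite eq | *-zeroʳ (b ^ suc i) = z≤n
    ... | inj₂ le = ≤-trans
      (≤-trans (≤-reflexive (solve 3 (λ b p v → b :* p :* v := p :* (b :* v)) refl b (b ^ i) (length (heavy A (suc i)))))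
               (*-monoʳ-≤ (b ^ i) (m≤m+n _ (2 * length F)))) le
      where open +-*-Solver

    sparse-deg : ∀ {F A m} → 4 ^ m * n ^ suc m < b ^ m → Sparse F A → ∀ x → deg A x < m
    sparse-deg {F} {A} {m} lt sp x = ≰⇒> λ m≤ → <⇒≱ lt (begin
        b ^ m                        ≡⟨ sym (*-identityʳ _) ⟩
        b ^ m * 1                    ≤⟨ *-monoʳ-≤ (b ^ m) (∈-length (∈-heavy⁺ {A} m≤)) ⟩
        b ^ m * length (heavy A m)   ≤⟨ heavy-bound sp m ⟩
        4 ^ m * n ^ suc m            ∎)
      where open ≤-Reasoning

    -- One round of the game. Avoider's edge adds at most two vertices to each `heavy` set, at a
    -- cost of `2 * b`, and Enforcer's claim of at least `b` edges lowers `2 * length F` by at least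
    -- as much.
    sparse-step : ∀ {F A e R S R′} → Sparse F A → (∀ {f} → f ∈ F → rank A e ≤ rank A f) →
                  Split F (e ∷ []) R → Split R S R′ → b ≤ length S → Sparse R′ (e ∷ A)
    sparse-step {F} {A} {e} {R} {S} {R′} sp min s₁ s₂ b≤ = record
      { unique = split-unique s₂ (split-unique s₁ (unique sp)) ; bounded = λ i → go i (bounded sp i) }
      where
      open ≤-Reasoning
      shrink : b + length R′ ≤ length F
      shrink = begin
        b + length R′                 ≤⟨ +-monoˡ-≤ _ b≤ ⟩
        length S + length R′          ≡⟨ split-length s₂ ⟩
        length R                      ≤⟨ n≤1+n _ ⟩
        suc (length R)                ≡⟨ split-length s₁ ⟩
        length F                      ∎
      go : ∀ i → Bounded F A i → Bounded R′ (e ∷ A) i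
      go i (inj₂ le) = inj₂ (begin
          b ^ i * (b * length (heavy (e ∷ A) (suc i)) + 2 * length R′)
            ≤⟨ *-monoʳ-≤ (b ^ i) (+-monoˡ-≤ _ (*-monoʳ-≤ b (length-heavy-∷ A e (suc i)))) ⟩
          b ^ i * (b * (2 + v) + 2 * length R′)
            ≡⟨ cong (b ^ i *_) (solve 3 (λ b v r → b :* (con 2 :+ v) :+ con 2 :* r := b :* v :+ con 2 :* (b :+ r)) refl b v (length R′)) ⟩
          b ^ i * (b * v + 2 * (b + length R′))
            ≤⟨ *-monoʳ-≤ (b ^ i) (+-monoʳ-≤ (b * v) (*-monoʳ-≤ 2 shrink)) ⟩
          b ^ i * (b * v + 2 * length F)
            ≤⟨ le ⟩
          4 ^ suc i * n ^ suc (suc i) ∎)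
        where open +-*-Solver
              v = length (heavy A (suc i))
      -- The first vertex of degree `suc i` may appear in this round. It is an endpoint of `e` and
      -- had degree `i` before, so minimality of `rank A e` forces every free edge to meet
      -- `heavy A i`, which bounds `length F`.
      go i (inj₁ none) with heavy (e ∷ A) (suc i) in eq
      ... | [] = inj₁ refl
      ... | x ∷ xs = inj₂ (begin
          b ^ i * (b * suc (length xs) + 2 * length R′)
            ≤⟨ *-monoʳ-≤ (b ^ i) (+-monoˡ-≤ _ (*-monoʳ-≤ b v≤2)) ⟩
          b ^ i * (b * 2 + 2 * length R′)
            ≡⟨ cong (b ^ i *_) (solve 2 (λ b r → b :* con 2 :+ con 2 :* r := con 2 :* (b :+ r)) refl b (length R′)) ⟩
          b ^ i * (2 * (b + length R′))
            ≤⟨ *-monoʳ-≤ (b ^ i) (*-monoʳ-≤ 2 (≤-trans shrink (length-covered (heavy A i) (unique sp) touched))) ⟩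
          b ^ i * (2 * (2 * (n * w)))
            ≡⟨ solve 3 (λ p n w → p :* (con 2 :* (con 2 :* (n :* w))) := con 4 :* n :* (p :* w)) refl (b ^ i) n w ⟩
          4 * n * (b ^ i * w)
            ≤⟨ *-monoʳ-≤ (4 * n) (heavy-bound sp i) ⟩
          4 * n * (4 ^ i * n ^ suc i)
            ≡⟨ solve 3 (λ n p q → con 4 :* n :* (p :* q) := con 4 :* p :* (n :* q)) refl n (4 ^ i) (n ^ suc i) ⟩
          4 ^ suc i * n ^ suc (suc i) ∎)
        where
        open +-*-Solver
        w = length (heavy A i)
        v≤2 : suc (length xs) ≤ 2
        v≤2 = begin
          suc (length xs)                        ≡⟨ cong length (sym eq) ⟩
          length (heavy (e ∷ A) (suc i))         ≤⟨ length-heavy-∷ A e (suc i) ⟩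
          2 + length (heavy A (suc i))           ≡⟨ cong (2 +_) none ⟩
          2                                      ∎
        x-heavy : suc i ≤ deg (e ∷ A) x
        x-heavy = ∈-heavy⁻ {e ∷ A} (subst (x ∈_) (sym eq) (here refl))
        x-light : deg A x < suc i
        x-light = ≰⇒> λ le → <⇒≢ (∈-length (∈-heavy⁺ {A} {suc i} le)) (sym none)
        i≤deg : i ≤ deg A x
        i≤deg = s≤s⁻¹ (≤-trans x-heavy (deg-∷-suc A e x))
        i≤rank : i ≤ rank A e
        i≤rank with incident? e x
        ... | yes (inj₁ refl) = ≤-trans i≤deg (m≤m⊔n _ _)
        ... | yes (inj₂ refl) = ≤-trans i≤deg (m≤n⊔m (deg A (proj₁ e)) _)
        ... | no ni = ⊥-elim (<⇒≱ x-light (≤-trans x-heavy (deg-∷-other {L = A} ni)))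
        touched : ∀ {f} → f ∈ F → proj₁ f ∈ heavy A i ⊎ proj₂ f ∈ heavy A i
        touched f∈ = rank≤⇒incident-heavy {A} (≤-trans i≤rank (min f∈))

    module _ (H : Graph) (m : ℕ) (lt : 4 ^ m * n ^ suc m < b ^ m)
             (safe-∷ : ∀ (A : List (Edge n)) e → (∀ x → deg A x < m) → ¬ ContainsCopy H (e ∷ A)) where

      safe : ∀ (A : List (Edge n)) → (∀ x → deg A x < m) → ¬ ContainsCopy H A
      -- Any additional edge will do. The copy itself supplies a vertex `φ 0`, so an element of
      -- `Edge n` is at hand without assuming `n` positive.
      safe A small c@(φ , _) = safe-∷ A (φ 0 , φ 0) small (containsCopy-mono H there c)

      mutual
        -- `Sparse` describes positions before Avoider's move only. If the game ends right after his
        -- edge `e`, or Enforcer takes all that remains, the degree bound holds for `A` alone, and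
        -- `safe-∷` covers the one extra edge.
        avoids : ∀ {F A} → Sparse F A → ¬ EnfWinsA H b F A
        avoids {A = A} sp (endA c) = safe A (sparse-deg lt sp) c
        avoids {A = A} sp (moveA {e} {F} f) =
          let (e₀ , e₀∈ , min) = minimal-rank A e F
              (R , s) = split-take e₀∈
          in avoids′ sp min s (f s ≤-refl)

        avoids′ : ∀ {F A e R} → Sparse F A → (∀ {f} → f ∈ F → rank A e ≤ rank A f) →
                  Split F (e ∷ []) R → ¬ EnfWinsE H b R (e ∷ A)
        avoids′ {A = A} {e} sp min s (endE c) = safe-∷ A e (sparse-deg lt sp) c
        avoids′ sp min s (moveE s₂ (inj₁ b≤) w) = avoids (sparse-step sp min s s₂ b≤) w
        avoids′ {A = A} {e} sp min s (moveE s₂ (inj₂ refl) (endA c)) = safe-∷ A e (sparse-deg lt sp) c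

      avoider-wins : ¬ EnforcerWins H n b
      avoider-wins = avoids record
        { unique = Unique.filter⁺ (λ p → toℕ (proj₁ p) <? toℕ (proj₂ p)) (Unique.cartesianProduct⁺ (Unique.allFin⁺ n) (Unique.allFin⁺ n))
        ; bounded = λ i → inj₁ (n≤0⇒n≡0 (length-⊆ {ys = []} (heavy-unique [] (suc i)) λ {x} x∈ →
            ⊥-elim (<⇒≱ (∈-heavy⁻ {[]} x∈) (≤-trans (≤-reflexive (deg-[] x)) z≤n))))
        }

-- Decidability of the game and existence of the threshold

prepend : ∀ {A : Set} → A → (ℕ → A) → ℕ → A
prepend x φ zero = x
prepend x φ (suc i) = φ i

-- There are infinitely many functions from `ℕ`, but `P` sees only the first `v` values, so it
-- suffices to search for these one at a time.
∃-function? : ∀ {n} v {P : (ℕ → Fin n) → Set} → (∀ φ → Dec (P φ)) →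
              (∀ {φ ψ} → (∀ i → i < v → φ i ≡ ψ i) → P φ → P ψ) → Dec (∃ P)
∃-function? {zero} v P? local = no λ (φ , _) → Fin.¬Fin0 (φ 0)
∃-function? {suc n} zero P? local = map′ (λ p → (λ _ → Fin.zero) , p) (λ (φ , p) → local (λ i ()) p) (P? (λ _ → Fin.zero))
∃-function? {suc n} (suc v) {P} P? local =
  map′ (λ (x , φ , p) → prepend x φ , p)
       (λ (φ , p) → φ 0 , φ ∘ suc , local (λ { zero _ → refl ; (suc i) _ → refl }) p)
       (Fin.any? λ x → ∃-function? v (λ φ → P? (prepend x φ))
         (λ eq → local λ { zero _ → refl ; (suc i) (s≤s lt) → eq i lt }))

-- Ensures that being a copy depends only on the values of `φ` below `verts H`, which makes the
-- search for `φ` finite.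
WellFormed : Graph → Set
WellFormed H = ∀ {a b} → (a , b) ∈ edges H → a < verts H × b < verts H

containsCopy? : ∀ H → WellFormed H → ∀ {n} (A : List (Edge n)) → Dec (ContainsCopy H A)
containsCopy? H wf {n} A = ∃-function? (verts H) embedding? local
  where
  Injective Preserving Embedding : (ℕ → Fin n) → Set
  Injective φ = ∀ x y → x < verts H → y < verts H → φ x ≡ φ y → x ≡ y
  Preserving φ = ∀ {a b} → (a , b) ∈ edges H → HasEdge A (φ a) (φ b)
  Embedding φ = Injective φ × Preserving φ

  injective? : ∀ φ → Dec (Injective φ)
  injective? φ = map′ (λ f x y x< y< → f x< y<) (λ f {x} x< {y} y< → f x y x< y<)
    (allUpTo? (λ x → allUpTo? (λ y → (φ x Fin.≟ φ y) →-dec (x ≟ y)) (verts H)) (verts H))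

  embedding? : ∀ φ → Dec (Embedding φ)
  embedding? φ = injective? φ ×-dec
    map′ (λ al p → All.lookup al p) (λ f → All.tabulate f) (All.all? (λ (a , b) → hasEdge? A (φ a) (φ b)) (edges H))

  local : ∀ {φ ψ} → (∀ i → i < verts H → φ i ≡ ψ i) → Embedding φ → Embedding ψ
  local eq (inj , pres) =
    (λ x y x< y< e → inj x y x< y< (trans (eq x x<) (trans e (sym (eq y y<))))) ,
    (λ p → subst₂ (HasEdge A) (eq _ (proj₁ (wf p))) (eq _ (proj₂ (wf p))) (pres p))

module _ {A : Set} where

  ∀-split? : ∀ (F : List A) {P : List A → List A → Set} → (∀ {S R} → Split F S R → Dec (P S R)) →
             Dec (∀ {S R} → Split F S R → P S R)
  ∀-split? [] P? with P? []
  ... | yes p = yes λ { [] → p }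
  ... | no ¬p = no λ h → ¬p (h [])
  ∀-split? (x ∷ F) {P} P? with ∀-split? F {λ S R → P (x ∷ S) R} (λ s → P? (inS s))
                              | ∀-split? F {λ S R → P S (x ∷ R)} (λ s → P? (inR s))
  ... | yes f | yes g = yes λ { (inS s) → f s ; (inR s) → g s }
  ... | no ¬f | _ = no λ h → ¬f λ s → h (inS s)
  ... | _ | no ¬g = no λ h → ¬g λ s → h (inR s)

  ∃-split? : ∀ (F : List A) {P : List A → List A → Set} → (∀ {S R} → Split F S R → Dec (P S R)) →
             Dec (∃ λ S → ∃ λ R → Split F S R × P S R)
  ∃-split? [] P? = map′ (λ p → [] , [] , [] , p) (λ { (_ , _ , [] , p) → p }) (P? [])
  ∃-split? (x ∷ F) {P} P? =
    map′ (λ { (inj₁ (S , R , s , p)) → x ∷ S , R , inS s , p ; (inj₂ (S , R , s , p)) → S , x ∷ R , inR s , p })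
         (λ { (_ , _ , inS s , p) → inj₁ (_ , _ , s , p) ; (_ , _ , inR s , p) → inj₂ (_ , _ , s , p) })
         (∃-split? F {λ S R → P (x ∷ S) R} (λ s → P? (inS s)) ⊎-dec ∃-split? F {λ S R → P S (x ∷ R)} (λ s → P? (inR s)))

empty? : ∀ {A : Set} (xs : List A) → Dec (xs ≡ [])
empty? [] = yes refl
empty? (x ∷ xs) = no λ ()

module _ (H : Graph) (wf : WellFormed H) {n : ℕ} (b : ℕ) where
  mutual
    -- `fuel` bounds the number of free edges. It drops at Avoider's moves, since he claims at least
    -- one edge, but not at Enforcer's, who may claim nothing when `b` is 0.
    enfWinsA? : ∀ fuel (F A : List (Edge n)) → length F ≤ fuel → Dec (EnfWinsA H b F A)
    enfWinsA? fuel [] A _ = map′ endA (λ { (endA c) → c }) (containsCopy? H wf A)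
    enfWinsA? (suc fuel) (e ∷ F) A (s≤s le) with ∀-split? (e ∷ F) {λ S R → 1 ≤ length S → EnfWinsE H b R (S ++ A)} reply?
      where
      reply? : ∀ {S R} → Split (e ∷ F) S R → Dec (1 ≤ length S → EnfWinsE H b R (S ++ A))
      reply? {[]} s = yes λ ()
      reply? {x ∷ S} {R} s = map′ (λ w _ → w) (λ f → f (s≤s z≤n))
        (enfWinsE? fuel R (x ∷ S ++ A)
          (≤-trans (m≤n+m (length R) (length S)) (≤-trans (≤-reflexive (suc-injective (split-length s))) le)))
    ... | yes f = yes (moveA f)
    ... | no ¬f = no λ { (moveA f) → ¬f f }

    enfWinsE? : ∀ fuel (F A : List (Edge n)) → length F ≤ fuel → Dec (EnfWinsE H b F A)
    enfWinsE? fuel [] A _ = map′ endE (λ { (endE c) → c }) (containsCopy? H wf A)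
    enfWinsE? fuel (e ∷ F) A le =
      map′ (λ (_ , _ , s , legal , w) → moveE s legal w) (λ { (moveE s legal w) → _ , _ , s , legal , w })
        (∃-split? (e ∷ F) λ {S} {R} s →
          ((b ≤? length S) ⊎-dec empty? R) ×-dec
          enfWinsA? fuel R A (≤-trans (m≤n+m (length R) (length S)) (≤-trans (≤-reflexive (split-length s)) le)))

  enforcerWins? : Dec (EnforcerWins H n b)
  enforcerWins? = enfWinsA? _ (edgesK n) [] ≤-refl

module _ (H : Graph) {n b b′ : ℕ} (b′≤b : b′ ≤ b) where
  mutual
    -- Under the monotone rules a claim of at least `b` edges remains legal for every smaller bias,
    -- so the same strategy works.
    enfWinsA-antitone : ∀ {F A : List (Edge n)} → EnfWinsA H b F A → EnfWinsA H b′ F A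
    enfWinsA-antitone (endA c) = endA c
    enfWinsA-antitone (moveA f) = moveA λ s le → enfWinsE-antitone (f s le)

    enfWinsE-antitone : ∀ {F A : List (Edge n)} → EnfWinsE H b F A → EnfWinsE H b′ F A
    enfWinsE-antitone (endE c) = endE c
    enfWinsE-antitone (moveE s (inj₁ le) w) = moveE s (inj₁ (≤-trans b′≤b le)) (enfWinsA-antitone w)
    enfWinsE-antitone (moveE s (inj₂ eq) w) = moveE s (inj₂ eq) (enfWinsA-antitone w)

last-true : ∀ {P : ℕ → Set} → (∀ i → Dec (P i)) → P 0 → ∀ B → ¬ P B → ∃ λ t → P t × ¬ P (suc t)
last-true P? p0 zero ¬pB = ⊥-elim (¬pB p0)
last-true P? p0 (suc B) ¬pB with P? B
... | yes pB = B , pB , ¬pB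
... | no ¬pB′ = last-true P? p0 B ¬pB′

-- Decidability locates a bias `t` won by Enforcer with `suc t` not won; antitonicity turns this
-- switch into the required equivalence.
threshold-exists : ∀ H → WellFormed H → ∀ n {b₀ B} → EnforcerWins H n b₀ → ¬ EnforcerWins H n B →
                   ∃ λ t → IsMonThreshold H n t
threshold-exists H wf n {b₀} {B} w ¬w =
  let (t , wt , ¬wt) = last-true (λ b → enforcerWins? H wf {n} b) (enfWinsA-antitone H z≤n w) B ¬w
  in t , λ b → mk⇔ (λ wb → ≮⇒≥ λ t<b → ¬wt (enfWinsA-antitone H t<b wb)) (λ b≤t → enfWinsA-antitone H b≤t wt)

-- Copies of the two graphs

-- Embeddings are given as vertex lists in the order in which the pattern numbers its vertices; the
-- default `d` only fills in indices beyond the list.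
nth : ∀ {A : Set} → A → List A → ℕ → A
nth d [] i = d
nth d (x ∷ xs) zero = x
nth d (x ∷ xs) (suc i) = nth d xs i

nth-∈ : ∀ {A : Set} (d : A) xs {i} → i < length xs → nth d xs i ∈ xs
nth-∈ d (x ∷ xs) {zero} _ = here refl
nth-∈ d (x ∷ xs) {suc i} (s≤s lt) = there (nth-∈ d xs lt)

nth-injective : ∀ {A : Set} (d : A) {xs} → Unique xs → ∀ i j → i < length xs → j < length xs →
                nth d xs i ≡ nth d xs j → i ≡ j
nth-injective d {x ∷ xs} u zero zero _ _ _ = refl
nth-injective d {x ∷ xs} u zero (suc j) _ (s≤s lt) eq = ⊥-elim (unique-head u (subst (_∈ xs) (sym eq) (nth-∈ d xs lt)))
nth-injective d {x ∷ xs} u (suc i) zero (s≤s lt) _ eq = ⊥-elim (unique-head u (subst (_∈ xs) eq (nth-∈ d xs lt)))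
nth-injective d {x ∷ xs} (_ ∷ u) (suc i) (suc j) (s≤s p) (s≤s q) eq = cong suc (nth-injective d u i j p q eq)

nth-++ˡ : ∀ {A : Set} (d : A) xs {ys i} → i < length xs → nth d (xs ++ ys) i ≡ nth d xs i
nth-++ˡ d (x ∷ xs) {i = zero} _ = refl
nth-++ˡ d (x ∷ xs) {i = suc i} (s≤s lt) = nth-++ˡ d xs lt

nth-++ʳ : ∀ {A : Set} (d : A) xs {ys} i → nth d (xs ++ ys) (length xs + i) ≡ nth d ys i
nth-++ʳ d [] i = refl
nth-++ʳ d (x ∷ xs) i = nth-++ʳ d xs i

∈-mapUpTo⁻ : ∀ {B : Set} (f : ℕ → B) k {x} → x ∈ map f (upTo k) → ∃ λ i → i < k × x ≡ f i
∈-mapUpTo⁻ f k p with ∈-map⁻ f p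
... | i , i∈ , eq = i , ∈-upTo⁻ i∈ , eq

2*suc : ∀ k → 2 * suc k ≡ 2 + (k + k)
2*suc = solve 1 (λ k → con 2 :* (con 1 :+ k) := con 2 :+ (k :+ k)) refl
  where open +-*-Solver

-- The edges of `doubleStar (suc k)`: with the index shifted, `k` is the number of leaves at each
-- centre and truncated subtraction disappears.
data DoubleStarEdge (k : ℕ) : ℕ × ℕ → Set where
  middle : DoubleStarEdge k (0 , 1)
  leaf₀  : ∀ {i} → i < k → DoubleStarEdge k (0 , 2 + i)
  leaf₁  : ∀ {i} → i < k → DoubleStarEdge k (1 , 2 + (k + i))

data PathDoubleStarEdge (k : ℕ) : ℕ × ℕ → Set where
  middle₀ : PathDoubleStarEdge k (0 , 2 * suc k)
  middle₁ : PathDoubleStarEdge k (1 , 2 * suc k)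
  leaf₀   : ∀ {i} → i < k → PathDoubleStarEdge k (0 , 2 + i)
  leaf₁   : ∀ {i} → i < k → PathDoubleStarEdge k (1 , 2 + (k + i))

doubleStarEdge⁻ : ∀ k {e} → e ∈ edges (doubleStar (suc k)) → DoubleStarEdge k e
doubleStarEdge⁻ k (here refl) = middle
doubleStarEdge⁻ k (there p) with ∈-++⁻ (map (λ i → (0 , 2 + i)) (upTo k)) p
... | inj₁ q with ∈-mapUpTo⁻ _ k q
... | i , lt , refl = leaf₀ lt
doubleStarEdge⁻ k (there p) | inj₂ q with ∈-mapUpTo⁻ _ k q
... | i , lt , refl = leaf₁ lt

doubleStarEdge⁺ : ∀ k {e} → DoubleStarEdge k e → e ∈ edges (doubleStar (suc k))
doubleStarEdge⁺ k middle = here refl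
doubleStarEdge⁺ k (leaf₀ lt) = there (∈-++⁺ˡ (∈-map⁺ _ (∈-upTo⁺ lt)))
doubleStarEdge⁺ k (leaf₁ lt) = there (∈-++⁺ʳ (map (λ i → (0 , 2 + i)) (upTo k)) (∈-map⁺ _ (∈-upTo⁺ lt)))

pathDoubleStarEdge⁻ : ∀ k {e} → e ∈ edges (pathDoubleStar (suc k)) → PathDoubleStarEdge k e
pathDoubleStarEdge⁻ k (here refl) = middle₀
pathDoubleStarEdge⁻ k (there (here refl)) = middle₁
pathDoubleStarEdge⁻ k (there (there p)) with ∈-++⁻ (map (λ i → (0 , 2 + i)) (upTo k)) p
... | inj₁ q with ∈-mapUpTo⁻ _ k q
... | i , lt , refl = leaf₀ lt
pathDoubleStarEdge⁻ k (there (there p)) | inj₂ q with ∈-mapUpTo⁻ _ k q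
... | i , lt , refl = leaf₁ lt

pathDoubleStarEdge⁺ : ∀ k {e} → PathDoubleStarEdge k e → e ∈ edges (pathDoubleStar (suc k))
pathDoubleStarEdge⁺ k middle₀ = here refl
pathDoubleStarEdge⁺ k middle₁ = there (here refl)
pathDoubleStarEdge⁺ k (leaf₀ lt) = there (there (∈-++⁺ˡ (∈-map⁺ _ (∈-upTo⁺ lt))))
pathDoubleStarEdge⁺ k (leaf₁ lt) = there (there (∈-++⁺ʳ (map (λ i → (0 , 2 + i)) (upTo k)) (∈-map⁺ _ (∈-upTo⁺ lt))))

module _ (k : ℕ) where

  centre₀< : 0 < 2 * suc k
  centre₀< = s≤s z≤n

  centre₁< : 1 < 2 * suc k
  centre₁< = ≤-trans (s≤s (s≤s z≤n)) (≤-reflexive (sym (2*suc k)))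

  leaf₀< : ∀ {i} → i < k → 2 + i < 2 * suc k
  leaf₀< lt = ≤-trans (s≤s (s≤s (≤-trans lt (m≤m+n k k)))) (≤-reflexive (sym (2*suc k)))

  leaf₁< : ∀ {i} → i < k → 2 + (k + i) < 2 * suc k
  leaf₁< lt = ≤-trans (s≤s (s≤s (+-monoʳ-< k lt))) (≤-reflexive (sym (2*suc k)))

  doubleStar-wf : WellFormed (doubleStar (suc k))
  doubleStar-wf p with doubleStarEdge⁻ k p
  ... | middle = centre₀< , centre₁<
  ... | leaf₀ lt = centre₀< , leaf₀< lt
  ... | leaf₁ lt = centre₁< , leaf₁< lt

  pathDoubleStar-wf : WellFormed (pathDoubleStar (suc k))
  pathDoubleStar-wf p with pathDoubleStarEdge⁻ k p
  ... | middle₀ = m≤n⇒m≤1+n centre₀< , ≤-refl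
  ... | middle₁ = m≤n⇒m≤1+n centre₁< , ≤-refl
  ... | leaf₀ lt = m≤n⇒m≤1+n centre₀< , m≤n⇒m≤1+n (leaf₀< lt)
  ... | leaf₁ lt = m≤n⇒m≤1+n centre₁< , m≤n⇒m≤1+n (leaf₁< lt)

  module _ {n : ℕ} {G : List (Edge n)} {u v : Fin n} {us vs : List (Fin n)}
           (|us| : length us ≡ k) (|vs| : length vs ≡ k)
           (Gu : ∀ {y} → y ∈ us → HasEdge G u y) (Gv : ∀ {y} → y ∈ vs → HasEdge G v y) where

    private
      nth-us : ∀ ws {i} → i < k → nth u (us ++ vs ++ ws) i ∈ us
      nth-us ws lt = subst (_∈ us) (sym (nth-++ˡ u us lt′)) (nth-∈ u us lt′)
        where lt′ = subst (_ <_) (sym |us|) lt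

      nth-vs : ∀ ws {i} → i < k → nth u (us ++ vs ++ ws) (k + i) ∈ vs
      nth-vs ws {i} lt = subst (_∈ vs) (sym eq) (nth-∈ u vs lt′)
        where
        lt′ = subst (_ <_) (sym |vs|) lt
        eq : nth u (us ++ vs ++ ws) (k + i) ≡ nth u vs i
        eq = trans (cong (λ j → nth u (us ++ vs ++ ws) (j + i)) (sym |us|))
               (trans (nth-++ʳ u us i) (nth-++ˡ u vs lt′))

      |us++vs| : ∀ ws → length (us ++ vs ++ ws) ≡ k + k + length ws
      |us++vs| ws = trans (length-++ us) (trans (cong₂ _+_ |us| (trans (length-++ vs) (cong (_+ length ws) |vs|))) (sym (+-assoc k k _)))

    doubleStar-copy : Unique (u ∷ v ∷ us ++ vs) → HasEdge G u v → ContainsCopy (doubleStar (suc k)) G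
    doubleStar-copy uniq Guv = φ ,
      (λ i j i< j< → nth-injective u uniq′ i j (bound i<) (bound j<)) , λ p → pres (doubleStarEdge⁻ k p)
      where
      -- The trailing `[]` gives the list the form `us ++ vs ++ ws` shared with the path double
      -- star, where `ws` holds the middle vertex.
      list = u ∷ v ∷ us ++ vs ++ []
      φ = nth u list
      uniq′ : Unique list
      uniq′ = subst (λ l → Unique (u ∷ v ∷ us ++ l)) (sym (++-identityʳ vs)) uniq
      bound : ∀ {i} → i < 2 * suc k → i < length list
      bound lt = ≤-trans lt (≤-reflexive (trans (2*suc k) (cong (2 +_) (sym (trans (|us++vs| []) (+-identityʳ _))))))
      pres : ∀ {a b} → DoubleStarEdge k (a , b) → HasEdge G (φ a) (φ b)
      pres middle = Guv
      pres (leaf₀ lt) = Gu (nth-us [] lt)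
      pres (leaf₁ lt) = Gv (nth-vs [] lt)

    pathDoubleStar-copy : ∀ {w} → Unique (u ∷ v ∷ us ++ vs ++ w ∷ []) → HasEdge G u w → HasEdge G v w →
                          ContainsCopy (pathDoubleStar (suc k)) G
    pathDoubleStar-copy {w} uniq Guw Gvw = φ ,
      (λ i j i< j< → nth-injective u uniq i j (bound i<) (bound j<)) , λ p → pres (pathDoubleStarEdge⁻ k p)
      where
      list = u ∷ v ∷ us ++ vs ++ w ∷ []
      φ = nth u list
      bound : ∀ {i} → i < suc (2 * suc k) → i < length list
      bound lt = ≤-trans lt (≤-reflexive (trans (cong suc (2*suc k)) (sym (trans (cong (2 +_) (|us++vs| (w ∷ []))) (+-comm (2 + (k + k)) 1)))))
      φ-last : w ≡ φ (2 * suc k)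
      φ-last = sym (trans (cong φ (2*suc k))
        (trans (cong₂ (λ i j → nth u (us ++ vs ++ w ∷ []) (i + j)) (sym |us|) (trans (sym |vs|) (sym (+-identityʳ _))))
        (trans (nth-++ʳ u us (length vs + 0)) (nth-++ʳ u vs 0))))
      pres : ∀ {a b} → PathDoubleStarEdge k (a , b) → HasEdge G (φ a) (φ b)
      pres middle₀ = subst (HasEdge G u) φ-last Guw
      pres middle₁ = subst (HasEdge G v) φ-last Gvw
      pres (leaf₀ lt) = Gu (nth-us (w ∷ []) lt)
      pres (leaf₁ lt) = Gv (nth-vs (w ∷ []) lt)

-- Degrees of the centres in a copy

unique-map : ∀ {A B : Set} (f : A → B) {xs} → (∀ {x y} → x ∈ xs → y ∈ xs → f x ≡ f y → x ≡ y) →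
             Unique xs → Unique (map f xs)
unique-map f {[]} inj u = []
unique-map f {x ∷ xs} inj u@(_ ∷ u′) = ∷-unique
  (λ p → let (y , y∈ , eq) = ∈-map⁻ f p in unique-head u (subst (_∈ xs) (sym (inj (here refl) (there y∈) eq)) y∈))
  (unique-map f (λ p q → inj (there p) (there q)) u′)

module _ {n : ℕ} where

  image-deg : ∀ {A : List (Edge n)} {φ : ℕ → Fin n} {v c is} →
              (∀ x y → x < v → y < v → φ x ≡ φ y → x ≡ y) → c < v → (∀ {i} → i ∈ is → i < v) →
              Unique (c ∷ is) → (∀ {i} → i ∈ is → HasEdge A (φ c) (φ i)) → length is ≤ deg A (φ c)
  image-deg {A} {φ} {v} {c} {is} inj c< is< u h = subst (_≤ deg A (φ c)) (length-map φ is)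
    (deg-lower {L = A} (unique-map φ (λ p q → inj _ _ (is< p) (is< q)) (unique-++⁻ʳ (c ∷ []) u)) λ y∈ → adj (∈-map⁻ φ y∈))
    where
    adj : ∀ {y} → (∃ λ i → i ∈ is × y ≡ φ i) → y ≢ φ c × HasEdge A (φ c) y
    adj (i , i∈ , refl) = (λ eq → unique-head u (subst (_∈ is) (inj _ _ (is< i∈) c< eq) i∈)) , h i∈

  -- The centre `0` has degree `suc k` in the pattern, and the single edge `e` raises its degree by
  -- at most one.
  doubleStar-safe : ∀ k (A : List (Edge n)) e → (∀ x → deg A x < k) → ¬ ContainsCopy (doubleStar (suc k)) (e ∷ A)
  doubleStar-safe k A e small (φ , inj , pres) = <⇒≱ (small (φ 0)) (s≤s⁻¹ (begin
      suc k                      ≡⟨ cong suc (sym (trans (length-map (2 +_) (upTo k)) (length-upTo k))) ⟩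
      length is                  ≤⟨ image-deg {A = e ∷ A} inj (centre₀< k) is< uniq h ⟩
      deg (e ∷ A) (φ 0)          ≤⟨ deg-∷-suc A e (φ 0) ⟩
      suc (deg A (φ 0))          ∎))
    where
    open ≤-Reasoning
    is = 1 ∷ map (2 +_) (upTo k)
    is< : ∀ {i} → i ∈ is → i < 2 * suc k
    is< (here refl) = centre₁< k
    is< (there p) with ∈-mapUpTo⁻ (2 +_) k p
    ... | i , lt , refl = leaf₀< k lt
    h : ∀ {i} → i ∈ is → HasEdge (e ∷ A) (φ 0) (φ i)
    h (here refl) = pres (doubleStarEdge⁺ k middle)
    h (there p) with ∈-mapUpTo⁻ (2 +_) k p
    ... | i , lt , refl = pres (doubleStarEdge⁺ k (leaf₀ lt))
    uniq : Unique (0 ∷ is)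
    uniq = ∷-unique (λ { (here ()) ; (there p) → zero∉ p }) (∷-unique one∉ (Unique.map⁺ (+-cancelˡ-≡ 2 _ _) (Unique.upTo⁺ k)))
      where
      zero∉ : 0 ∉ map (2 +_) (upTo k)
      zero∉ p with ∈-mapUpTo⁻ (2 +_) k p
      ... | _ , _ , ()
      one∉ : 1 ∉ map (2 +_) (upTo k)
      one∉ p with ∈-mapUpTo⁻ (2 +_) k p
      ... | _ , _ , ()

  module PathStars (k : ℕ) (A : List (Edge n)) (e : Edge n) (small : ∀ x → deg A x < suc k) (φ : ℕ → Fin n)
      (inj : ∀ x y → x < suc (2 * suc k) → y < suc (2 * suc k) → φ x ≡ φ y → x ≡ y)
      (pres : ∀ {a b} → (a , b) ∈ edges (pathDoubleStar (suc k)) → HasEdge (e ∷ A) (φ a) (φ b)) where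

    -- The pattern neighbours of a centre: the middle vertex and the `k` leaves, with offset `o = 0`
    -- for the centre `0` and `o = k` for the centre `1`.
    tips : ℕ → List ℕ
    tips o = 2 * suc k ∷ map (λ i → 2 + (o + i)) (upTo k)

    2≤tips : ∀ o {i} → i ∈ tips o → 2 ≤ i
    2≤tips o (here refl) = centre₁< k
    2≤tips o (there p) with ∈-mapUpTo⁻ _ k p
    ... | i , lt , refl = s≤s (s≤s z≤n)

    arm : ∀ c o → c < 2 → (∀ {i} → i < k → 2 + (o + i) < 2 * suc k) →
          ¬ (∀ {i} → i ∈ tips o → HasEdge A (φ c) (φ i))
    arm c o c<2 leaf< h = <⇒≱ (small (φ c)) (subst (_≤ deg A (φ c))
        (cong suc (trans (length-map (λ i → 2 + (o + i)) (upTo k)) (length-upTo k)))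
        (image-deg {A = A} inj (≤-trans c<2 (m≤n⇒m≤1+n (centre₁< k))) tips< uniq h))
      where
      tips< : ∀ {i} → i ∈ tips o → i < suc (2 * suc k)
      tips< (here refl) = ≤-refl
      tips< (there p) with ∈-mapUpTo⁻ _ k p
      ... | i , lt , refl = m≤n⇒m≤1+n (leaf< lt)
      last∉ : 2 * suc k ∉ map (λ i → 2 + (o + i)) (upTo k)
      last∉ p with ∈-mapUpTo⁻ _ k p
      ... | i , lt , eq = <⇒≢ (leaf< lt) (sym eq)
      uniq : Unique (c ∷ tips o)
      uniq = ∷-unique (λ p → <⇒≱ c<2 (2≤tips o p))
        (∷-unique last∉ (Unique.map⁺ (λ eq → +-cancelˡ-≡ o _ _ (+-cancelˡ-≡ 2 _ _ eq)) (Unique.upTo⁺ k)))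

    arm-edge₀ : ∀ {i} → i ∈ tips 0 → HasEdge (e ∷ A) (φ 0) (φ i)
    arm-edge₀ (here refl) = pres (pathDoubleStarEdge⁺ k middle₀)
    arm-edge₀ (there p) with ∈-mapUpTo⁻ _ k p
    ... | i , lt , refl = pres (pathDoubleStarEdge⁺ k (leaf₀ lt))

    arm-edge₁ : ∀ {i} → i ∈ tips k → HasEdge (e ∷ A) (φ 1) (φ i)
    arm-edge₁ (here refl) = pres (pathDoubleStarEdge⁺ k middle₁)
    arm-edge₁ (there p) with ∈-mapUpTo⁻ _ k p
    ... | i , lt , refl = pres (pathDoubleStarEdge⁺ k (leaf₁ lt))

    φ₁≢φ₀ : φ 1 ≢ φ 0
    φ₁≢φ₀ eq with () ← inj 1 0 (m≤n⇒m≤1+n (centre₁< k)) (s≤s z≤n) eq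

    apart : ∀ {i} → i ∈ tips 0 → φ 1 ≢ φ i
    apart {i} p eq = <⇒≢ (2≤tips 0 p) (inj 1 i (m≤n⇒m≤1+n (centre₁< k)) (i< p) eq)
      where
      i< : ∀ {i} → i ∈ tips 0 → i < suc (2 * suc k)
      i< (here refl) = ≤-refl
      i< (there p) with ∈-mapUpTo⁻ _ k p
      ... | i , lt , refl = m≤n⇒m≤1+n (leaf₀< k lt)

    -- The pattern edges at the centre `0` do not meet the centre `1`, so none of them is `e` once
    -- `e` contains `φ 1`.
    old : Incident e (φ 1) → ∀ {y} → φ 1 ≢ y → HasEdge (e ∷ A) (φ 0) y → HasEdge A (φ 0) y
    old (inj₁ eq) ne (inj₁ (here refl)) = ⊥-elim (φ₁≢φ₀ eq)
    old (inj₂ eq) ne (inj₁ (here refl)) = ⊥-elim (ne eq)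
    old (inj₁ eq) ne (inj₂ (here refl)) = ⊥-elim (ne eq)
    old (inj₂ eq) ne (inj₂ (here refl)) = ⊥-elim (φ₁≢φ₀ eq)
    old _ ne (inj₁ (there p)) = inj₁ p
    old _ ne (inj₂ (there p)) = inj₂ p

  -- Both centres have degree `suc k` and are not adjacent in the pattern. Hence `e` is used at no
  -- more than one of them, and all `suc k` edges at the other lie in `A`, against the degree bound.
  pathDoubleStar-safe : ∀ k (A : List (Edge n)) e → (∀ x → deg A x < suc k) → ¬ ContainsCopy (pathDoubleStar (suc k)) (e ∷ A)
  pathDoubleStar-safe k A e small (φ , inj , pres) with incident? e (φ 0) | incident? e (φ 1)
  ... | no ni | _ = arm 0 0 (s≤s z≤n) (leaf₀< k) λ p → hasEdge-∷⁻ ni (arm-edge₀ p)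
    where open PathStars k A e small φ inj pres
  ... | yes _ | no ni = arm 1 k (s≤s (s≤s z≤n)) (leaf₁< k) λ p → hasEdge-∷⁻ ni (arm-edge₁ p)
    where open PathStars k A e small φ inj pres
  ... | yes _ | yes i₁ = arm 0 0 (s≤s z≤n) (leaf₀< k) λ p → old i₁ (apart p) (arm-edge₀ p)
    where open PathStars k A e small φ inj pres

-- Finding the two stars

unique-two-stars : ∀ {A : Set} {u v : A} {us vs} → u ≢ v → u ∉ us → u ∉ vs → v ∉ us → v ∉ vs →
                   Unique us → Unique vs → (∀ {z} → z ∈ us → z ∉ vs) → Unique (u ∷ v ∷ us ++ vs)
unique-two-stars {us = us} u≢v u∉us u∉vs v∉us v∉vs uus uvs disj =
  ∷-unique (λ { (here eq) → u≢v eq ; (there p) → outside u∉us u∉vs p })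
    (∷-unique (outside v∉us v∉vs) (unique-++⁺ uus uvs disj))
  where
  outside : ∀ {y} → y ∉ us → y ∉ _ → y ∉ us ++ _
  outside p q r with ∈-++⁻ us r
  ... | inj₁ s = p s
  ... | inj₂ s = q s

-- The pattern numbers the middle vertex last, while the constructions below produce it at the head
-- of a list.
∈-rotate : ∀ {A : Set} {z w : A} xs → z ∈ xs ++ w ∷ [] → z ∈ w ∷ xs
∈-rotate xs p with ∈-++⁻ xs p
... | inj₁ q = there q
... | inj₂ (here refl) = here refl

unique-rotate : ∀ {A : Set} {w : A} {xs} → Unique (w ∷ xs) → Unique (xs ++ w ∷ [])
unique-rotate u@(_ ∷ u′) = unique-++⁺ u′ (∷-unique (λ ()) []) λ { p (here refl) → unique-head u p }

-- A vertex of this degree has `m` neighbours outside any given set of `suc m` vertices.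
critical : ℕ → ℕ
critical m = suc m + suc m

-- One more than the number of vertices in or next to an `m`-star with its centre, if all degrees
-- are below `critical m`; see `bad` in `low-degree-stars`.
enough : ℕ → ℕ
enough m = suc (suc m + suc m * critical m)

module _ {n : ℕ} where

  -- The stars are disjoint and `star-x` misses `u`, but `x` may be a leaf of `star-u`. The link
  -- lemmas deal with that case.
  record Stars (G : List (Edge n)) (m : ℕ) (u x : Fin n) : Set where
    field
      x≢u      : x ≢ u
      star-u   : Selection (nbrs G u) [] m
      star-x   : Selection (nbrs G x) (u ∷ Selection.chosen star-u) m

  open Selection

  -- The star at `u` is chosen first; the large degree of `x` leaves enough neighbours outside it.
  high-degree-stars : ∀ {G m u x} → x ≢ u → m ≤ deg G u → critical m ≤ deg G x → Stars G m u x
  high-degree-stars {G} {m} {u} {x} x≢u le crit = record { x≢u = x≢u ; star-u = su ; star-x = sx }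
    where
    su = select [] m (nbrs-unique G u) le
    sx : Selection (nbrs G x) (u ∷ chosen su) m
    sx = select (u ∷ chosen su) m (nbrs-unique G x)
      (≤-trans (≤-reflexive (cong (λ l → suc l + m) (size su))) (≤-trans (+-monoʳ-≤ (suc m) (n≤1+n m)) crit))

  module _ {G₀ G : List (Edge n)} (G₀⊆G : G₀ ⊆ G) {m : ℕ} where

    -- Before the move `u` had fewer than `m` neighbours, so some `x` in `Old` was not among them. A
    -- star of `x` in the earlier graph `G₀` therefore avoids `u`, and the large new degree of `u`
    -- provides a star disjoint from it.
    high-degree-new : ∀ {u} Old → Unique Old → (∀ {x} → x ∈ Old → m ≤ deg G₀ x) → m ≤ length Old →
                      deg G₀ u < m → critical m ≤ deg G u → ∃ λ x → Stars G m u x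
    high-degree-new {u} Old uniq old |Old| new crit =
      let (x , x∈ , x∉) = fresh (nbrs G₀ u) uniq (≤-trans new |Old|)
      in x , build x (old x∈) x∉
      where
      build : ∀ x → m ≤ deg G₀ x → x ∉ nbrs G₀ u → Stars G m u x
      build x le x∉ = record
        { x≢u = λ { refl → <⇒≱ new le }
        ; star-u = record { chosen = chosen su ; unique = unique su ; size = size su ; inside = inside su ; outside = λ _ () }
        ; star-x = record
          { chosen = chosen sx ; unique = unique sx ; size = size sx
          ; inside = nbrs-mono {L = G₀} x G₀⊆G ∘ inside sx
          ; outside = λ { p (here refl) → x∉ (nbrs-sym {L = G₀} (inside sx p)) ; p (there q) → outside su q (there p) }
          }
        }
        where
        sx = select {xs = nbrs G₀ x} [] m (nbrs-unique G₀ x) le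
        su : Selection (nbrs G u) (x ∷ chosen sx) m
        su = select (x ∷ chosen sx) m (nbrs-unique G u)
          (≤-trans (≤-reflexive (cong (λ l → suc l + m) (size sx))) (≤-trans (+-monoʳ-≤ (suc m) (n≤1+n m)) crit))

    -- All degrees being bounded, only a bounded number of vertices lie in or next to `near`. Any
    -- other `x` in `T` has no neighbour in `near`, so every star at `x` fits.
    low-degree-stars : ∀ {u} T → Unique T → (∀ {x} → x ∈ T → m ≤ deg G x) → enough m ≤ length T → m ≤ deg G u →
                       (∀ y → deg G y < critical m) → ∃ λ x → Stars G m u x
    low-degree-stars {u} T uniq heavyT |T| le low =
      let (x , x∈ , x∉) = fresh bad uniq (≤-trans (s≤s |bad|) |T|) in x , build x (heavyT x∈) x∉
      where
      su = select {xs = nbrs G u} [] m (nbrs-unique G u) le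
      near = u ∷ chosen su
      bad = near ++ concatMap (nbrs G) near
      |bad| : length bad ≤ suc m + suc m * critical m
      |bad| = begin
        length bad                                          ≡⟨ length-++ near ⟩
        length near + length (concatMap (nbrs G) near)      ≡⟨ cong (length near +_) (length-concatMap (nbrs G) near) ⟩
        length near + Σ[ deg G ] near                       ≤⟨ +-monoʳ-≤ (length near) (Σ-upper near λ {y} _ → <⇒≤ (low y)) ⟩
        length near + length near * critical m              ≡⟨ cong (λ l → suc l + suc l * critical m) (size su) ⟩
        suc m + suc m * critical m                          ∎
        where open ≤-Reasoning
      build : ∀ x → m ≤ deg G x → x ∉ bad → Stars G m u x
      build x lex x∉ = record
        { x≢u = λ { refl → x∉ (here refl) }
        ; star-u = su
        ; star-x = record
          { chosen = chosen sx ; unique = unique sx ; size = size sx ; inside = inside sx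
          ; outside = λ p q → x∉ (∈-++⁺ʳ near (∈-concatMap⁺ (nbrs G) (lose q (nbrs-sym {L = G} (inside sx p)))))
          }
        }
        where sx = select {xs = nbrs G x} [] m (nbrs-unique G x) lex

    -- The degree condition on New before the last move is what handles a
    -- single new vertex that jumps to large degree.
    stars-exist : ∀ Old New → Unique Old → Unique New →
                  (∀ {x} → x ∈ Old → m ≤ deg G₀ x) → (∀ {x} → x ∈ New → deg G₀ x < m × m ≤ deg G x) →
                  0 < length New → enough m ≤ length Old + length New →
                  ∃ λ u → u ∈ New × ∃ λ x → Stars G m u x
    stars-exist Old (u ∷ New) uo un old new _ |T| with Fin.any? (λ y → critical m ≤? deg G y)
    ... | no none = u , here refl , low-degree-stars (Old ++ u ∷ New)
          (unique-++⁺ uo un λ p q → <⇒≱ (proj₁ (new q)) (old p)) heavyT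
          (≤-trans |T| (≤-reflexive (sym (length-++ Old)))) (proj₂ (new (here refl)))
          (λ y → ≰⇒> λ le → none (y , le))
      where
      heavyT : ∀ {x} → x ∈ Old ++ u ∷ New → m ≤ deg G x
      heavyT {x} p with ∈-++⁻ Old p
      ... | inj₁ q = ≤-trans (old q) (deg-mono {L = G₀} x G₀⊆G)
      ... | inj₂ q = proj₂ (new q)
    ... | yes (y , crit) with y Fin.≟ u
    ...   | no y≢u = u , here refl , y , high-degree-stars {G} y≢u (proj₂ (new (here refl))) crit
    -- The vertex of critical degree is `u` itself, so the other new vertex `u′` takes over the role
    -- of the centre that was active until now.
    stars-exist Old (u ∷ u′ ∷ New) uo un old new _ |T| | yes (y , crit) | yes refl =
      u′ , there (here refl) , u ,
      high-degree-stars {G} (λ eq → unique-head un (here eq)) (proj₂ (new (there (here refl)))) crit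
    stars-exist Old (u ∷ []) uo un old new _ |T| | yes (y , crit) | yes refl =
      u , here refl , high-degree-new Old uo old
        (≤-trans (≤-trans (n≤1+n m) (m≤m+n (suc m) _)) (s≤s⁻¹ (≤-trans |T| (≤-reflexive (+-comm (length Old) 1)))))
        (proj₁ (new (here refl))) crit

  -- Enforcer owns no edge at `u`; this holds for active vertices.
  Covered : (F G : List (Edge n)) → Fin n → Set
  Covered F G u = ∀ {y} → y ≢ u → HasEdge F u y ⊎ HasEdge G u y

  -- In the second alternative Enforcer wins by making `e` the last free edge, if the bias allows
  -- it.
  WonByEdge : Graph → (F G : List (Edge n)) → Set
  WonByEdge H F G = ContainsCopy H G ⊎ ∃ λ e → e ∈ F × ContainsCopy H (e ∷ G)

  link : ∀ {H F G u y} → HasEdge F u y ⊎ HasEdge G u y →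
         (∀ {G′} → G ⊆ G′ → HasEdge G′ u y → ContainsCopy H G′) → WonByEdge H F G
  link (inj₂ g) copy = inj₁ (copy (λ p → p) g)
  link (inj₁ (inj₁ p)) copy = inj₂ (_ , p , copy there (inj₁ (here refl)))
  link (inj₁ (inj₂ p)) copy = inj₂ (_ , p , copy there (inj₂ (here refl)))

  module _ {G : List (Edge n)} {m : ℕ} {u x : Fin n} (st : Stars G m u x) where
    open Stars st

    star-u-adjacent : ∀ {G′ y} → G ⊆ G′ → y ∈ chosen star-u → HasEdge G′ u y
    star-u-adjacent sub p = hasEdge-mono {L = G} sub (proj₂ (∈-nbrs⁻ {L = G} (inside star-u p)))

    star-x-adjacent : ∀ {G′ y} → G ⊆ G′ → y ∈ chosen star-x → HasEdge G′ x y
    star-x-adjacent sub p = hasEdge-mono {L = G} sub (proj₂ (∈-nbrs⁻ {L = G} (inside star-x p)))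

    u∉star-u : u ∉ chosen star-u
    u∉star-u p = proj₁ (∈-nbrs⁻ {L = G} (inside star-u p)) refl

    x∉star-x : x ∉ chosen star-x
    x∉star-x p = proj₁ (∈-nbrs⁻ {L = G} (inside star-x p)) refl

    u∉star-x : u ∉ chosen star-x
    u∉star-x p = outside star-x p (here refl)

    stars-disjoint : ∀ {z} → z ∈ chosen star-u → z ∉ chosen star-x
    stars-disjoint p q = outside star-x q (there p)

  doubleStar-link : ∀ {k F G u x} → suc (suc k) + suc (suc k) < n → Stars G (suc k) u x → Covered F G u →
                    WonByEdge (doubleStar (suc (suc k))) F G
  doubleStar-link {k} {F} {G} {u} {x} big st cov with DecMembership._∈?_ Fin._≟_ x (chosen (Stars.star-u st))
  ... | no x∉ = link (cov x≢u) λ sub ux → doubleStar-copy (suc k) (size star-u) (size star-x)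
          (star-u-adjacent st sub) (star-x-adjacent st sub)
          (unique-two-stars (x≢u ∘ sym) (u∉star-u st) (u∉star-x st) x∉ (x∉star-x st)
            (unique star-u) (unique star-x) (stars-disjoint st)) ux
    where open Stars st
  -- Now `ux` is present but costs `u` a leaf. A vertex `z` outside both stars replaces that leaf,
  -- and `uz` is the missing edge.
  ... | yes x∈ = let (z , _ , z∉) = free in extend z z∉
    where
    open Stars st
    rest = select {xs = chosen star-u} (x ∷ []) k (unique star-u) (≤-reflexive (sym (size star-u)))
    used = u ∷ x ∷ chosen star-u ++ chosen star-x
    |used| : length used ≡ suc (suc k) + suc (suc k)
    |used| = trans (cong (2 +_) (trans (length-++ (chosen star-u)) (cong₂ _+_ (size star-u) (size star-x)))) (cong suc (sym (+-suc (suc k) (suc k))))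
    free = fresh used (Unique.allFin⁺ n) (≤-trans (≤-reflexive (cong suc |used|)) (≤-trans big (≤-reflexive (sym length-allFin))))
    extend : ∀ z → z ∉ used → WonByEdge (doubleStar (suc (suc k))) F G
    extend z z∉ = link (cov (λ { refl → z∉ (here refl) })) λ sub uz →
          doubleStar-copy (suc k) (cong suc (size rest)) (size star-x)
          (λ { (here refl) → uz ; (there p) → star-u-adjacent st sub (inside rest p) }) (star-x-adjacent st sub)
          (unique-two-stars (x≢u ∘ sym) (λ { (here refl) → z∉ (here refl) ; (there p) → u∉star-u st (inside rest p) }) (u∉star-x st)
            (λ { (here refl) → z∉ (there (here refl)) ; (there p) → outside rest p (here refl) }) (x∉star-x st)
            (∷-unique (λ p → z∉ (there (there (∈-++⁺ˡ (inside rest p))))) (unique rest)) (unique star-x)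
            (λ { (here refl) q → z∉ (there (there (∈-++⁺ʳ (chosen star-u) q))) ; (there p) → stars-disjoint st (inside rest p) }))
          (star-u-adjacent st sub x∈)

  -- One leaf `w` of `star-x` becomes the middle vertex and `uw` is the missing edge. This leaves
  -- `k` leaves for `x`, and `u` can spare one leaf, so `x` is dropped from `star-u` if it occurs
  -- there.
  pathDoubleStar-link : ∀ {k F G u x} → Stars G (suc k) u x → Covered F G u →
                        WonByEdge (pathDoubleStar (suc k)) F G
  pathDoubleStar-link {k} {F} {G} {u} {x} st cov = go (chosen star-x) refl
    where
    open Stars st
    rest = select {xs = chosen star-u} (x ∷ []) k (unique star-u) (≤-reflexive (sym (size star-u)))
    go : ∀ ws → chosen star-x ≡ ws → WonByEdge (pathDoubleStar (suc k)) F G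
    go [] eq with () ← trans (sym (size star-x)) (cong length eq)
    go (w ∷ ws) eq = link (cov λ { refl → u∉star-x st (back (here refl)) }) λ sub uw →
        pathDoubleStar-copy k (size rest) (suc-injective (trans (cong length (sym eq)) (size star-x)))
          (star-u-adjacent st sub ∘ inside rest) (star-x-adjacent st sub ∘ back ∘ there)
          (unique-two-stars (x≢u ∘ sym) (u∉star-u st ∘ inside rest) (u∉star-x st ∘ back ∘ ∈-rotate ws)
            (λ p → outside rest p (here refl)) (x∉star-x st ∘ back ∘ ∈-rotate ws)
            (unique rest) (unique-rotate (subst Unique eq (unique star-x)))
            (λ p → stars-disjoint st (inside rest p) ∘ back ∘ ∈-rotate ws))
          uw (star-x-adjacent st sub (back (here refl)))
      where
      back : w ∷ ws ⊆ chosen star-x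
      back = subst (_ ∈_) (sym eq)

  -- The configuration for positions with at most `b` free edges, where Enforcer cannot leave a
  -- single edge. Each spoke is joined by Avoider to all but at most `h` of the other vertices.
  record Hub (F G : List (Edge n)) (k h : ℕ) : Set where
    field
      spokes    : List (Fin n)
      centre    : Fin n
      unique-sp : Unique spokes
      size-sp   : length spokes ≡ k
      away      : centre ∉ spokes
      joined    : ∀ {g} → g ∈ spokes → HasEdge G g centre
      covered   : ∀ {g} → g ∈ spokes → Covered F G g
      sparse    : ∀ {g} → g ∈ spokes → deg F g ≤ h

  record Leaves (G : List (Edge n)) (g : Fin n) (B : List (Fin n)) (j : ℕ) : Set where
    field
      leaves : List (Fin n)
      uniq   : Unique leaves
      count  : length leaves ≡ j
      adj    : ∀ {y} → y ∈ leaves → HasEdge G g y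
      self   : g ∉ leaves
      avoid  : ∀ {y} → y ∈ leaves → y ∉ B

  -- Since `g` is covered, every vertex outside `g`, `nbrs F g` and `B` is already a neighbour of
  -- `g` in `G`.
  grow : ∀ {F G g h} B j → Covered F G g → deg F g ≤ h → suc (h + length B) + j ≤ n → Leaves G g B j
  grow {F} {G} {g} {h} B j cov le big = record
    { leaves = chosen s ; uniq = unique s ; count = size s
    ; adj = adj ; self = λ p → outside s p (here refl)
    ; avoid = λ p q → outside s p (there (∈-++⁺ʳ (nbrs F g) q)) }
    where
    s = select {xs = allFin n} (g ∷ nbrs F g ++ B) j (Unique.allFin⁺ n) (begin
      suc (length (nbrs F g ++ B)) + j   ≡⟨ cong (λ l → suc l + j) (length-++ (nbrs F g)) ⟩
      suc (deg F g + length B) + j       ≤⟨ +-monoˡ-≤ j (s≤s (+-monoˡ-≤ (length B) le)) ⟩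
      suc (h + length B) + j             ≤⟨ big ⟩
      n                                  ≡⟨ sym length-allFin ⟩
      length (allFin n)                  ∎)
      where open ≤-Reasoning
    adj : ∀ {y} → y ∈ chosen s → HasEdge G g y
    adj p with cov (λ eq → outside s p (here eq))
    ... | inj₂ e = e
    ... | inj₁ e = ⊥-elim (outside s p (there (∈-++⁺ˡ (∈-nbrs⁺ {L = F} (λ eq → outside s p (here eq)) e))))

  open Leaves

  -- One spoke and the hub's centre are the two centres: the remaining spokes are the leaves of the
  -- latter, and the spoke grows its own.
  doubleStar-hub : ∀ {k F G h} → suc (h + suc k) + k ≤ n → Hub F G (suc k) h → ContainsCopy (doubleStar (suc k)) G
  doubleStar-hub {k} {F} {G} {h} big hub = go spokes refl
    where
    open Hub hub
    go : ∀ gs → spokes ≡ gs → ContainsCopy (doubleStar (suc k)) G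
    go [] eq with () ← trans (sym size-sp) (cong length eq)
    go (g ∷ gs) eq = doubleStar-copy k (count ls) |gs| (adj ls) (λ p → hasEdge-sym {L = G} (joined (back (there p))))
        (unique-two-stars (λ { refl → away (back (here refl)) }) (self ls) (unique-head ugs) (λ p → avoid ls p (here refl))
          (away ∘ back ∘ there) (uniq ls) (unique-++⁻ʳ (g ∷ []) ugs) (λ p q → avoid ls p (there q)))
        (joined (back (here refl)))
      where
      back : g ∷ gs ⊆ spokes
      back = subst (_ ∈_) (sym eq)
      ugs = subst Unique eq unique-sp
      |gs| : length gs ≡ k
      |gs| = suc-injective (trans (cong length (sym eq)) size-sp)
      ls = grow {F} {G} {g} (centre ∷ gs) k (covered (back (here refl))) (sparse (back (here refl)))
             (subst (λ l → suc (h + suc l) + k ≤ n) (sym |gs|) big)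

  -- Two spokes serve as centres and the hub's centre as middle vertex; the leaves are grown one
  -- star after the other.
  pathDoubleStar-hub : ∀ {k F G h} → suc (h + suc (suc k)) + k ≤ n → Hub F G (suc k) h → 1 ≤ k →
                       ContainsCopy (pathDoubleStar (suc k)) G
  pathDoubleStar-hub {k} {F} {G} {h} big hub 1≤k = go spokes refl
    where
    open Hub hub
    go : ∀ gs → spokes ≡ gs → ContainsCopy (pathDoubleStar (suc k)) G
    go [] eq with () ← trans (sym size-sp) (cong length eq)
    go (g ∷ []) eq = ⊥-elim (<⇒≢ 1≤k (suc-injective (trans (cong length (sym eq)) size-sp)))
    go (g ∷ g′ ∷ gs) eq = pathDoubleStar-copy k (count ls) (count ls′) (adj ls) (adj ls′)
        (unique-two-stars (λ e → unique-head ugs (here e)) (self ls) (λ p → g∉ (∈-rotate (leaves ls′) p))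
          (λ p → avoid ls p (here refl)) (λ p → g′∉ (∈-rotate (leaves ls′) p)) (uniq ls)
          (unique-rotate (∷-unique (λ p → avoid ls′ p (there (here refl))) (uniq ls′)))
          (λ p q → disj p (∈-rotate (leaves ls′) q)))
        (joined (back (here refl))) (joined (back (there (here refl))))
      where
      back : g ∷ g′ ∷ gs ⊆ spokes
      back = subst (_ ∈_) (sym eq)
      ugs = subst Unique eq unique-sp
      ls = grow {F} {G} {g} (g′ ∷ centre ∷ []) k (covered (back (here refl))) (sparse (back (here refl)))
             (≤-trans (+-monoˡ-≤ k (s≤s (+-monoʳ-≤ h (s≤s (s≤s z≤n))))) big)
      ls′ = grow {F} {G} {g′} (g ∷ centre ∷ leaves ls) k (covered (back (there (here refl)))) (sparse (back (there (here refl))))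
             (subst (λ l → suc (h + suc (suc l)) + k ≤ n) (sym (count ls)) big)
      g∉ : g ∉ centre ∷ leaves ls′
      g∉ (here refl) = away (back (here refl))
      g∉ (there p) = avoid ls′ p (here refl)
      g′∉ : g′ ∉ centre ∷ leaves ls′
      g′∉ (here refl) = away (back (there (here refl)))
      g′∉ (there p) = self ls′ p
      disj : ∀ {z} → z ∈ leaves ls → z ∉ centre ∷ leaves ls′
      disj p (here refl) = avoid ls p (there (here refl))
      disj p (there q) = avoid ls′ q (there (there p))

-- Enforcer's strategy

take-++-⊆ : ∀ {A : Set} j (xs : List A) {ys} → j ≤ length xs → take j (xs ++ ys) ⊆ xs
take-++-⊆ (suc j) (x ∷ xs) le (here refl) = here refl
take-++-⊆ (suc j) (x ∷ xs) (s≤s le) (there p) = there (take-++-⊆ j xs le p)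

drop-++-⊆ : ∀ {A : Set} j (xs : List A) {ys} → length xs ≤ j → drop j (xs ++ ys) ⊆ ys
drop-++-⊆ zero [] le p = p
drop-++-⊆ (suc j) [] {y ∷ ys} le p = there (drop-++-⊆ j [] z≤n p)
drop-++-⊆ (suc j) (x ∷ xs) (s≤s le) p = drop-++-⊆ j xs le p

module _ {n : ℕ} where

  handshake : ∀ {V} (L : List (Edge n)) → Unique V → Σ[ deg L ] V ≤ 2 * length L
  handshake {V} [] u = ≤-trans (Σ-upper {c = 0} V λ {x} _ → ≤-reflexive (deg-[] x)) (≤-reflexive (*-zeroʳ (length V)))
  handshake {V} (e@(a , c) ∷ L) u = begin
      Σ[ deg (e ∷ L) ] V
        ≡⟨ Σ-filter (deg (e ∷ L)) (incident? e) V ⟩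
      Σ[ deg (e ∷ L) ] I + Σ[ deg (e ∷ L) ] O
        ≤⟨ +-mono-≤ (Σ-mono I λ {x} _ → deg-∷-suc L e x)
                    (Σ-mono O λ p → deg-∷-other {L = L} (proj₂ (∈-filter⁻ (¬? ∘ incident? e) {xs = V} p))) ⟩
      Σ[ (λ x → 1 + deg L x) ] I + Σ[ deg L ] O
        ≡⟨ cong (_+ Σ[ deg L ] O) (trans (Σ-+ (λ _ → 1) (deg L) I) (cong (_+ Σ[ deg L ] I) (trans (Σ-const 1 I) (*-identityʳ _)))) ⟩
      length I + Σ[ deg L ] I + Σ[ deg L ] O
        ≡⟨ trans (+-assoc (length I) _ _) (cong (length I +_) (sym (Σ-filter (deg L) (incident? e) V))) ⟩
      length I + Σ[ deg L ] V
        ≤⟨ +-mono-≤ (length-⊆ (Unique.filter⁺ (incident? e) u) I⊆) (handshake L u) ⟩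
      2 + 2 * length L
        ≡⟨ sym (*-suc 2 (length L)) ⟩
      2 * suc (length L) ∎
    where
    open ≤-Reasoning
    I = filter (incident? e) V
    O = filter (¬? ∘ incident? e) V
    I⊆ : I ⊆ a ∷ c ∷ []
    I⊆ p with proj₂ (∈-filter⁻ (incident? e) {xs = V} p)
    ... | inj₁ refl = here refl
    ... | inj₂ refl = there (here refl)

  length-cover : ∀ {xs : List (Fin n)} → (∀ y → y ∈ xs) → n ≤ length xs
  length-cover h = ≤-trans (≤-reflexive (sym length-allFin)) (length-⊆ (Unique.allFin⁺ n) (λ {y} _ → h y))

  covered-[] : ∀ {A u} → Covered {n} [] A u → n ≤ suc (deg A u)
  covered-[] {A} {u} cov = length-cover go
    where
    go : ∀ y → y ∈ u ∷ nbrs A u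
    go y with y Fin.≟ u
    ... | yes refl = here refl
    ... | no y≢u with cov y≢u
    ...   | inj₂ e = there (∈-nbrs⁺ {L = A} y≢u e)
    ...   | inj₁ (inj₁ ())
    ...   | inj₁ (inj₂ ())

  -- `HasEdge` ignores orientation, so disjointness alone would not exclude a reversed copy of a
  -- free edge in `A`; the order conditions do.
  record Board (F A : List (Edge n)) : Set where
    field
      unique   : Unique F
      orderedF : ∀ {a c} → (a , c) ∈ F → toℕ a < toℕ c
      orderedA : ∀ {a c} → (a , c) ∈ A → toℕ a < toℕ c
      disjoint : ∀ {e} → e ∈ F → e ∉ A

  board-initial : Board (edgesK n) []
  board-initial = record
    { unique = Unique.filter⁺ ordered? (Unique.cartesianProduct⁺ (Unique.allFin⁺ n) (Unique.allFin⁺ n))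
    ; orderedF = λ p → proj₂ (∈-filter⁻ ordered? {xs = cartesianProduct (allFin n) (allFin n)} p)
    ; orderedA = λ () ; disjoint = λ _ () }
    where ordered? = λ (p : Edge n) → toℕ (proj₁ p) <? toℕ (proj₂ p)

  covered-initial : ∀ u → Covered (edgesK n) [] u
  covered-initial u {y} y≢u with <-cmp (toℕ u) (toℕ y)
  ... | tri< lt _ _ = inj₁ (inj₁ (∈-filter⁺ _ (∈-cartesianProduct⁺ (∈-allFin u) (∈-allFin y)) lt))
  ... | tri≈ _ eq _ = ⊥-elim (y≢u (sym (Fin.toℕ-injective eq)))
  ... | tri> _ _ gt = inj₁ (inj₂ (∈-filter⁺ _ (∈-cartesianProduct⁺ (∈-allFin y) (∈-allFin u)) gt))

  board-claim : ∀ {F A S R} → Split F S R → Board F A → Board R (S ++ A)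
  board-claim {F} {A} {S} s bd = record
    { unique = split-unique s unique
    ; orderedF = orderedF ∘ split-right s
    ; orderedA = λ p → ordered (∈-++⁻ S p)
    ; disjoint = λ p q → apart p (∈-++⁻ S q) }
    where
    open Board bd
    ordered : ∀ {a c} → (a , c) ∈ S ⊎ (a , c) ∈ A → toℕ a < toℕ c
    ordered (inj₁ p) = orderedF (split-left s p)
    ordered (inj₂ p) = orderedA p
    apart : ∀ {e} → e ∈ _ → e ∈ S ⊎ e ∈ A → ⊥
    apart p (inj₁ q) = split-disjoint s unique p q
    apart p (inj₂ q) = disjoint (split-right s p) q

  board-discard : ∀ {F A S R} → Split F S R → Board F A → Board R A
  board-discard s bd = record
    { unique = split-unique s unique ; orderedF = orderedF ∘ split-right s
    ; orderedA = orderedA ; disjoint = disjoint ∘ split-right s }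
    where open Board bd

  covered-claim : ∀ {F A S R : List (Edge n)} {u} → Split F S R → Covered F A u → Covered R (S ++ A) u
  covered-claim {A = A} {S} {R} {u} s cov {y} y≢u with cov y≢u
  ... | inj₂ e = inj₂ (hasEdge-mono {L = A} {S ++ A} (∈-++⁺ʳ S) e)
  ... | inj₁ (inj₁ p) with split-cover s p
  ...   | inj₁ q = inj₂ (inj₁ (∈-++⁺ˡ q))
  ...   | inj₂ q = inj₁ (inj₁ q)
  covered-claim {A = A} {S} {R} {u} s cov {y} y≢u | inj₁ (inj₂ p) with split-cover s p
  ...   | inj₁ q = inj₂ (inj₂ (∈-++⁺ˡ q))
  ...   | inj₂ q = inj₁ (inj₂ q)

  fresh-edge : ∀ {F A a c} → Board F A → (a , c) ∈ F → c ≢ a × ¬ HasEdge A a c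
  fresh-edge bd p = (λ { refl → <-irrefl refl (orderedF p) }) ,
    λ { (inj₁ q) → disjoint p q ; (inj₂ q) → <-asym (orderedF p) (orderedA q) }
    where open Board bd

  deg-strict : ∀ {A B : List (Edge n)} {u y} → A ⊆ B → y ≢ u → ¬ HasEdge A u y → HasEdge B u y → suc (deg A u) ≤ deg B u
  deg-strict {A} {B} {u} {y} sub y≢u ne e = deg-lower {L = B} {ys = y ∷ nbrs A u}
    (∷-unique (λ p → ne (proj₂ (∈-nbrs⁻ {L = A} p))) (nbrs-unique A u))
    λ { (here refl) → y≢u , e ; (there p) → proj₁ (∈-nbrs⁻ {L = A} p) , hasEdge-mono {L = A} {B} sub (proj₂ (∈-nbrs⁻ {L = A} p)) }

  module _ (H : Graph) (b : ℕ) where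

    win-now : ∀ {F A} → ContainsCopy H A → EnfWinsE H {n} b F A
    win-now {[]} c = endE c
    win-now {e ∷ F} c = moveE (split-all (e ∷ F)) (inj₂ refl) (endA c)

    enforcer-move : ∀ {F A S R} → Split F S R → b ≤ length S → 0 < length F → EnfWinsA H b R A → EnfWinsE H {n} b F A
    enforcer-move {e ∷ F} s le _ w = moveE s (inj₁ le) w

    -- Enforcer claims everything except `e`, and Avoider must then take it.
    leave-one : ∀ {F A e} → e ∈ F → b < length F → ContainsCopy H (e ∷ A) → EnfWinsE H {n} b F A
    leave-one {F} {A} {e} e∈ lt c =
      let (R , s) = split-take e∈ in
      enforcer-move (split-swap s) (s≤s⁻¹ (≤-trans lt (≤-reflexive (sym (split-length s))))) (≤-trans (s≤s z≤n) lt)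
        (moveA λ { (inS []) _ → endE c ; (inR []) () })

module Enforcer (H : Graph) {n : ℕ} (k m′ D h : ℕ)
  (4h≤n : 4 * h ≤ n) (m<h : suc m′ < h) (k<h : suc k < h) (0<D : 0 < D)
  (link-wins : ∀ {F G : List (Edge n)} {u x} → Stars G (suc m′) u x → Covered F G u → WonByEdge H F G)
  (hub-wins : ∀ {F G : List (Edge n)} → Hub F G (suc k) h → ContainsCopy H G)
  where

  -- `K` vertices of degree `m` suffice for `stars-exist`. The factor 3 in `reserve` serves
  -- `exhausted`: up to `2 * suc k * D` active vertices may have too many free edges, and `suc k`
  -- others must remain.
  m q b K reserve : ℕ
  m = suc m′
  q = suc D
  b = D * h
  K = enough m
  reserve = 3 * suc k

  open Selection

  -- A budget in units of `q ^ m`: `K` for the vertices in `Old`, `reserve` to keep `reserve * q`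
  -- vertices active, and one unit for each of the `r` times that the level `ℓ` can still rise.
  goal : ℕ → ℕ
  goal r = (K + reserve + r) * q ^ m

  weight : List (Edge n) → Fin n → ℕ
  weight A u = q ^ (m ⊓ deg A u)

  weight-mono : ∀ {A B} u → A ⊆ B → weight A u ≤ weight B u
  weight-mono {A} u sub = ^-monoʳ-≤ q (⊓-monoʳ-≤ m (deg-mono {L = A} u sub))

  weight≤ : ∀ A u → weight A u ≤ q ^ m
  weight≤ A u = ^-monoʳ-≤ q (m⊓n≤m m (deg A u))

  weight-below : ∀ {A u j} → deg A u ≤ j → weight A u ≤ q ^ j
  weight-below {A} {u} le = ^-monoʳ-≤ q (≤-trans (m⊓n≤n m (deg A u)) le)

  0<h : 0 < h
  0<h = ≤-trans (s≤s z≤n) m<h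

  m<n : m < n
  m<n = ≤-trans m<h (≤-trans (m≤m+n h _) 4h≤n)

  -- The invariant before Avoider's move. `Old` collects vertices that reached degree `m` while
  -- active; they keep contributing `q ^ m` each. `ℓ` is a lower bound for all active degrees.
  record Position (F A : List (Edge n)) : Set where
    field
      Act Old  : List (Fin n)
      ℓ r      : ℕ
      levels   : ℓ + r ≡ m
      board    : Board F A
      act-uniq : Unique Act
      old-uniq : Unique Old
      low      : ∀ {u} → u ∈ Act → ℓ ≤ deg A u
      act      : ∀ {u} → u ∈ Act → deg A u < m
      old      : ∀ {x} → x ∈ Old → m ≤ deg A x
      few-old  : length Old < K
      few-act  : length Act ≤ h
      covered  : ∀ {u} → u ∈ Act → Covered F A u
      touching : ∀ {e} → e ∈ F → proj₁ e ∈ Act ⊎ proj₂ e ∈ Act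
      potential : goal r ≤ Σ[ weight A ] Act + length Old * q ^ m

  -- The invariant before Enforcer's move. `act` and `old` refer to Avoider's previous graph `A₀`,
  -- so a vertex that has just reached degree `m` still counts as active and is covered. `potential`
  -- includes the gain of Avoider's move.
  record Response (F A₀ A : List (Edge n)) : Set where
    field
      Act Old  : List (Fin n)
      ℓ r      : ℕ
      levels   : ℓ + r ≡ m
      board    : Board F A
      grown    : A₀ ⊆ A
      act-uniq : Unique Act
      old-uniq : Unique Old
      low      : ∀ {u} → u ∈ Act → ℓ ≤ deg A u
      act      : ∀ {u} → u ∈ Act → deg A₀ u < m
      old      : ∀ {x} → x ∈ Old → m ≤ deg A₀ x
      few-old  : length Old < K
      few-act  : length Act ≤ h
      many-act : reserve * q ≤ length Act
      covered  : ∀ {u} → u ∈ Act → Covered F A u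
      potential : goal r + D * q ^ ℓ ≤ Σ[ weight A ] Act + length Old * q ^ m

  -- `Old` carries less than `K * q ^ m`, so at least `reserve * q ^ m` lies on active vertices,
  -- each of weight at most `q ^ m′`.
  many-active : ∀ {A r} Act o → o < K → (∀ {u} → u ∈ Act → deg A u < m) →
                goal r ≤ Σ[ weight A ] Act + o * q ^ m → reserve * q ≤ length Act
  many-active {A} {r} Act o o<K act pot = *-cancelʳ-≤ (reserve * q) (length Act) (q ^ m′) {{m^n≢0 q m′}} (begin
      reserve * q * q ^ m′     ≡⟨ *-assoc reserve q (q ^ m′) ⟩
      reserve * q ^ m          ≤⟨ +-cancelʳ-≤ (o * q ^ m) (reserve * q ^ m) (Σ[ weight A ] Act) bound ⟩
      Σ[ weight A ] Act        ≤⟨ Σ-upper Act (λ p → weight-below {A} (s≤s⁻¹ (act p))) ⟩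
      length Act * q ^ m′      ∎)
    where
    open ≤-Reasoning
    bound : reserve * q ^ m + o * q ^ m ≤ Σ[ weight A ] Act + o * q ^ m
    bound = begin
      reserve * q ^ m + o * q ^ m    ≡⟨ trans (+-comm (reserve * q ^ m) _) (sym (*-distribʳ-+ (q ^ m) o reserve)) ⟩
      (o + reserve) * q ^ m          ≤⟨ *-monoˡ-≤ (q ^ m) (≤-trans (+-monoˡ-≤ reserve (<⇒≤ o<K)) (m≤m+n (K + reserve) r)) ⟩
      goal r                         ≤⟨ pot ⟩
      Σ[ weight A ] Act + o * q ^ m  ∎

  -- A step from degree `d` to `suc d` gains `D * q ^ d`, because `q` is `suc D`, and `d` is at
  -- least `ℓ`.
  weight-jump : ∀ {A B u ℓ} → ℓ ≤ deg A u → deg A u < m → suc (deg A u) ≤ deg B u → weight A u + D * q ^ ℓ ≤ weight B u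
  weight-jump {A} {B} {u} {ℓ} ℓ≤ lt le = begin
      weight A u + D * q ^ ℓ        ≤⟨ +-mono-≤ (weight-below {A} ≤-refl) (*-monoʳ-≤ D (^-monoʳ-≤ q ℓ≤)) ⟩
      q ^ deg A u + D * q ^ deg A u ≡⟨⟩
      q ^ suc (deg A u)             ≤⟨ ^-monoʳ-≤ q (⊓-glb lt le) ⟩
      weight B u                    ∎
    where open ≤-Reasoning

  after-avoider : ∀ {F A S R} → Position F A → Split F S R → 1 ≤ length S → Response R A (S ++ A)
  after-avoider {F} {A} {S} {R} pos s 1≤S = record
    { Act = Act ; Old = Old ; ℓ = ℓ ; r = r ; levels = levels
    ; board = board-claim s board ; grown = A⊆
    ; act-uniq = act-uniq ; old-uniq = old-uniq
    ; low = λ {u} p → ≤-trans (low p) (deg-mono {L = A} u A⊆)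
    ; act = act ; old = old ; few-old = few-old ; few-act = few-act
    ; many-act = many-active {A} {r} Act (length Old) few-old act potential
    ; covered = λ p → covered-claim {A = A} s (covered p)
    ; potential = begin
        goal r + D * q ^ ℓ
          ≤⟨ +-monoˡ-≤ _ potential ⟩
        Σ[ weight A ] Act + length Old * q ^ m + D * q ^ ℓ
          ≡⟨ solve 3 (λ x y z → x :+ y :+ z := x :+ z :+ y) refl (Σ[ weight A ] Act) (length Old * q ^ m) (D * q ^ ℓ) ⟩
        Σ[ weight A ] Act + D * q ^ ℓ + length Old * q ^ m
          ≤⟨ +-monoˡ-≤ _ (raise S refl 1≤S) ⟩
        Σ[ weight (S ++ A) ] Act + length Old * q ^ m ∎
    }
    where
    open Position pos
    open ≤-Reasoning
    open +-*-Solver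
    A⊆ : A ⊆ S ++ A
    A⊆ = ∈-++⁺ʳ S
    bump : ∀ {u y} → u ∈ Act → y ≢ u → ¬ HasEdge A u y → HasEdge (S ++ A) u y →
           Σ[ weight A ] Act + D * q ^ ℓ ≤ Σ[ weight (S ++ A) ] Act
    bump u∈ y≢u ne e = Σ-bump Act (λ {x} _ → weight-mono {A} x A⊆) u∈
      (weight-jump {A} {S ++ A} (low u∈) (act u∈) (deg-strict {A = A} A⊆ y≢u ne e))
    -- The first claimed edge already secures the gain; further edges do no harm, since weights only
    -- grow with the graph.
    raise : ∀ S′ → S ≡ S′ → 1 ≤ length S′ → Σ[ weight A ] Act + D * q ^ ℓ ≤ Σ[ weight (S ++ A) ] Act
    raise ((a , c) ∷ S′) eq _ = go (touching (split-left s e∈S))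
      where
      e∈S : (a , c) ∈ S
      e∈S = subst ((a , c) ∈_) (sym eq) (here refl)
      new = fresh-edge board (split-left s e∈S)
      go : a ∈ Act ⊎ c ∈ Act → _
      go (inj₁ p) = bump p (proj₁ new) (proj₂ new) (inj₁ (∈-++⁺ˡ e∈S))
      go (inj₂ p) = bump p (proj₁ new ∘ sym) (proj₂ new ∘ hasEdge-sym {L = A}) (inj₂ (∈-++⁺ˡ e∈S))

  -- With at most b free edges left, almost every edge at the active vertices is Avoider's.
  exhausted : ∀ {F A Act} → Unique Act → (∀ {u} → u ∈ Act → Covered F A u) → reserve * q ≤ length Act →
              length F ≤ b → Hub F A (suc k) h
  exhausted {F} {A} {Act} uniq cov many F≤b = hub (fresh used (Unique.allFin⁺ n) |used|)
    where
    open ≤-Reasoning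
    open +-*-Solver
    -- Together `suc k` good vertices have at most `h` free edges, so some vertex `w` is joined to
    -- all of them by Avoider.
    good? : Decidable (λ u → suc k * deg F u ≤ h)
    good? u = suc k * deg F u ≤? h
    Good = filter good? Act
    Bad = filter (¬? ∘ good?) Act
    -- Double counting: a bad vertex has more than `h / suc k` free edges, while the free edges have
    -- at most `2 * b` ends.
    |Bad| : length Bad * h ≤ suc k * 2 * D * h
    |Bad| = begin
      length Bad * h                          ≤⟨ Σ-lower Bad (λ p → <⇒≤ (≰⇒> (proj₂ (∈-filter⁻ (¬? ∘ good?) {xs = Act} p)))) ⟩
      Σ[ (λ u → suc k * deg F u) ] Bad        ≡⟨ Σ-* (suc k) (deg F) Bad ⟩
      suc k * Σ[ deg F ] Bad                  ≤⟨ *-monoʳ-≤ (suc k) (handshake F (Unique.filter⁺ (¬? ∘ good?) uniq)) ⟩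
      suc k * (2 * length F)                  ≤⟨ *-monoʳ-≤ (suc k) (*-monoʳ-≤ 2 F≤b) ⟩
      suc k * (2 * (D * h))                   ≡⟨ solve 3 (λ k d h → k :* (con 2 :* (d :* h)) := k :* con 2 :* d :* h) refl (suc k) D h ⟩
      suc k * 2 * D * h                       ∎
    |Good| : suc k ≤ length Good
    |Good| = +-cancelˡ-≤ (length Bad) (suc k) (length Good) (begin
      length Bad + suc k           ≤⟨ +-monoˡ-≤ (suc k) (*-cancelʳ-≤ (length Bad) (suc k * 2 * D) h {{>-nonZero 0<h}} |Bad|) ⟩
      suc k * 2 * D + suc k        ≤⟨ m≤m+n _ (suc k * 2 + suc k * D) ⟩
      suc k * 2 * D + suc k + (suc k * 2 + suc k * D)
                                   ≡⟨ solve 2 (λ k d → k :* con 2 :* d :+ k :+ (k :* con 2 :+ k :* d) := con 3 :* k :* (con 1 :+ d)) refl (suc k) D ⟩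
      reserve * q                  ≤⟨ many ⟩
      length Act                   ≡⟨ length-filter-¬ good? Act ⟩
      length Good + length Bad     ≡⟨ +-comm (length Good) (length Bad) ⟩
      length Bad + length Good     ∎)
    sel = select {xs = Good} [] (suc k) (Unique.filter⁺ good? uniq) |Good|
    gs = chosen sel
    good : ∀ {g} → g ∈ gs → g ∈ Act × suc k * deg F g ≤ h
    good p = ∈-filter⁻ good? {xs = Act} (inside sel p)
    used = concatMap (λ g → g ∷ nbrs F g) gs
    |used| : length used < length (allFin n)
    |used| = begin-strict
      length used                                ≡⟨ length-concatMap (λ g → g ∷ nbrs F g) gs ⟩
      Σ[ (λ g → 1 + deg F g) ] gs                ≡⟨ Σ-+ (λ _ → 1) (deg F) gs ⟩
      Σ[ (λ _ → 1) ] gs + Σ[ deg F ] gs          ≤⟨ +-mono-≤ (≤-reflexive (trans (Σ-1 gs) (size sel))) Σdeg ⟩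
      suc k + h                                  <⟨ +-monoˡ-< h k<h ⟩
      h + h                                      ≤⟨ m≤m+n (h + h) (h + h) ⟩
      h + h + (h + h)                            ≡⟨ solve 1 (λ h → h :+ h :+ (h :+ h) := con 4 :* h) refl h ⟩
      4 * h                                      ≤⟨ 4h≤n ⟩
      n                                          ≡⟨ sym length-allFin ⟩
      length (allFin n)                          ∎
      where
      Σdeg : Σ[ deg F ] gs ≤ h
      Σdeg = *-cancelˡ-≤ (suc k) (begin
        suc k * Σ[ deg F ] gs                    ≡⟨ sym (Σ-* (suc k) (deg F) gs) ⟩
        Σ[ (λ u → suc k * deg F u) ] gs          ≤⟨ Σ-upper gs (proj₂ ∘ good) ⟩
        length gs * h                            ≡⟨ cong (_* h) (size sel) ⟩
        suc k * h                                ∎)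
    hub : ∃ (λ w → w ∈ allFin n × w ∉ used) → Hub F A (suc k) h
    hub (w , _ , w∉) = record
      { spokes = gs ; centre = w ; unique-sp = unique sel ; size-sp = size sel
      ; away = λ p → w∉ (∈-concatMap⁺ _ (lose p (here refl)))
      ; joined = joined
      ; covered = λ p → cov (proj₁ (good p))
      ; sparse = λ {g} p → ≤-trans (m≤m+n (deg F g) _) (proj₂ (good p)) }
      where
      joined : ∀ {g} → g ∈ gs → HasEdge A g w
      joined {g} p with cov (proj₁ (good p)) {w} (λ { refl → w∉ (∈-concatMap⁺ _ (lose p (here refl))) })
      ... | inj₂ e = e
      ... | inj₁ e = ⊥-elim (w∉ (∈-concatMap⁺ _ (lose p (there (∈-nbrs⁺ {L = F} (λ { refl → w∉ (∈-concatMap⁺ _ (lose p (here refl))) }) e)))))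

  module Discard {F A : List (Edge n)} (X Act : List (Fin n)) (uniq : Unique (X ++ Act)) (few : length Act ≤ h)
                 (|X| : length X ≡ D) (light : ∀ {u} → u ∈ X → deg A u < m) (cov : ∀ {u} → u ∈ X → Covered F A u) where
    open DecMembership (Fin._≟_ {n}) using (_∈?_)

    touches? : Decidable (λ (e : Edge n) → proj₁ e ∈ Act ⊎ proj₂ e ∈ Act)
    touches? e = (proj₁ e ∈? Act) ⊎-dec (proj₂ e ∈? Act)

    killed kept : List (Edge n)
    killed = filter (¬? ∘ touches?) F
    kept = filter touches? F

    -- Of the at least `4 * h` vertices, at most `h` are still active, and at most `h` are `u` or
    -- Avoider's neighbours of `u`. All others are joined to `u` by killed edges.
    killed-deg : ∀ {u} → u ∈ X → 2 * h ≤ deg killed u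
    killed-deg {u} u∈ = +-cancelˡ-≤ (2 * h) (2 * h) (deg killed u) (begin
        2 * h + 2 * h                                   ≡⟨ solve 1 (λ h → con 2 :* h :+ con 2 :* h := con 4 :* h) refl h ⟩
        4 * h                                           ≤⟨ 4h≤n ⟩
        n                                               ≤⟨ length-cover cover ⟩
        suc (length (Act ++ nbrs A u ++ nbrs killed u)) ≡⟨ cong suc (trans (length-++ Act) (cong (length Act +_) (length-++ (nbrs A u)))) ⟩
        suc (length Act + (deg A u + deg killed u))     ≡⟨ solve 3 (λ x y z → con 1 :+ (x :+ (y :+ z)) := x :+ (con 1 :+ y) :+ z) refl (length Act) (deg A u) (deg killed u) ⟩
        length Act + suc (deg A u) + deg killed u       ≤⟨ +-monoˡ-≤ _ (+-mono-≤ few (≤-trans (light u∈) (<⇒≤ m<h))) ⟩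
        h + h + deg killed u                            ≡⟨ cong (_+ deg killed u) (cong (h +_) (sym (+-identityʳ h))) ⟩
        2 * h + deg killed u                            ∎)
      where
      open ≤-Reasoning
      open +-*-Solver
      u∉ : u ∉ Act
      u∉ = unique-++-disjoint X uniq u∈
      cover : ∀ y → y ∈ u ∷ Act ++ nbrs A u ++ nbrs killed u
      cover y with y Fin.≟ u | y ∈? Act
      ... | yes refl | _ = here refl
      ... | no _ | yes p = there (∈-++⁺ˡ p)
      ... | no y≢u | no y∉ with cov u∈ y≢u
      ...   | inj₂ e = there (∈-++⁺ʳ Act (∈-++⁺ˡ (∈-nbrs⁺ {L = A} y≢u e)))
      ...   | inj₁ e = there (∈-++⁺ʳ Act (∈-++⁺ʳ (nbrs A u) (∈-nbrs⁺ {L = killed} y≢u (lift e))))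
        where
        lift : HasEdge F u y → HasEdge killed u y
        lift (inj₁ p) = inj₁ (∈-filter⁺ (¬? ∘ touches?) p λ { (inj₁ q) → u∉ q ; (inj₂ q) → y∉ q })
        lift (inj₂ p) = inj₂ (∈-filter⁺ (¬? ∘ touches?) p λ { (inj₁ q) → y∉ q ; (inj₂ q) → u∉ q })

    -- An edge is counted at most twice in the degrees over `X`, so `D` vertices of killed degree
    -- `2 * h` account for `D * h` edges.
    enough-killed : b ≤ length killed
    enough-killed = *-cancelˡ-≤ 2 (begin
        2 * (D * h)              ≡⟨ solve 2 (λ d h → con 2 :* (d :* h) := d :* (con 2 :* h)) refl D h ⟩
        D * (2 * h)              ≡⟨ cong (_* (2 * h)) (sym |X|) ⟩
        length X * (2 * h)       ≤⟨ Σ-lower X killed-deg ⟩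
        Σ[ deg killed ] X        ≤⟨ handshake killed (unique-++⁻ˡ X uniq) ⟩
        2 * length killed        ∎)
      where
      open ≤-Reasoning
      open +-*-Solver

    covered-kept : ∀ {u} → u ∈ Act → Covered F A u → Covered kept A u
    covered-kept u∈ c y≢u with c y≢u
    ... | inj₂ e = inj₂ e
    ... | inj₁ (inj₁ p) = inj₁ (inj₁ (∈-filter⁺ touches? p (inj₁ u∈)))
    ... | inj₁ (inj₂ p) = inj₁ (inj₂ (∈-filter⁺ touches? p (inj₂ u∈)))

  -- With `K` vertices of degree `m` Enforcer finishes the game. Otherwise he moves the newly heavy
  -- vertices to `Old`, deactivates `D` others and claims every free edge that no longer meets an
  -- active vertex.
  respond : ∀ {F A₀ A} → Response F A₀ A → (∀ {R} → length R ≤ length F → Position R A → EnfWinsA H b R A) →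
            EnfWinsE H b F A
  respond {F} {A₀} {A} res continue with K ≤? length (Response.Old res) + length (filter (λ u → m ≤? deg A u) (Response.Act res))
  ... | yes K≤ = terminal (stars-exist grown Old New old-uniq (Unique.filter⁺ done? act-uniq) old new 0<New K≤)
    where
    open Response res
    done? = λ u → m ≤? deg A u
    New = filter done? Act
    new : ∀ {u} → u ∈ New → deg A₀ u < m × m ≤ deg A u
    new p = let (u∈ , le) = ∈-filter⁻ done? {xs = Act} p in act u∈ , le
    0<New : 0 < length New
    0<New = +-cancelˡ-< (length Old) 0 (length New) (≤-trans (≤-reflexive (cong suc (+-identityʳ _))) (≤-trans few-old K≤))
    terminal : (∃ λ u → u ∈ New × ∃ λ x → Stars A m u x) → EnfWinsE H b F A
    terminal (u , u∈ , x , st) with link-wins st (covered (proj₁ (∈-filter⁻ done? {xs = Act} u∈)))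
    ... | inj₁ c = win-now H b c
    -- Leaving only `e` is legal if more than `b` edges are free; otherwise so few are free that
    -- Avoider's graph contains a copy already.
    ... | inj₂ (e , e∈ , c) with b <? length F
    ...   | yes lt = leave-one H b e∈ lt c
    ...   | no ≮ = win-now H b (hub-wins (exhausted act-uniq covered many-act (≮⇒≥ ≮)))
  ... | no K≰ = discard r levels pot
    where
    open Response res
    open ≤-Reasoning
    open +-*-Solver
    done? = λ u → m ≤? deg A u
    New = filter done? Act
    Rest = filter (¬? ∘ done?) Act
    rest : ∀ {u} → u ∈ Rest → u ∈ Act × deg A u < m
    rest p = let (u∈ , ≰) = ∈-filter⁻ (¬? ∘ done?) {xs = Act} p in u∈ , ≰⇒> ≰
    rest-uniq = Unique.filter⁺ (¬? ∘ done?) act-uniq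
    bottom? = λ u → deg A u ≤? ℓ
    Low = filter bottom? Rest
    High = filter (¬? ∘ bottom?) Rest
    low-high : ∀ {u} → u ∈ Low ++ High → u ∈ Rest
    low-high p with ∈-++⁻ Low p
    ... | inj₁ s = proj₁ (∈-filter⁻ bottom? s)
    ... | inj₂ s = proj₁ (∈-filter⁻ (¬? ∘ bottom?) s)
    -- Vertices of degree `ℓ` go first. If there are `D` of them, their weight is what Avoider's
    -- move gained; if not, all of them go and the level rises.
    X = take D (Low ++ High)
    Act′ = drop D (Low ++ High)
    X++Act′ : X ++ Act′ ≡ Low ++ High
    X++Act′ = take++drop≡id D (Low ++ High)
    X⊆ : X ⊆ Low ++ High
    X⊆ p = subst (_ ∈_) X++Act′ (∈-++⁺ˡ p)
    Act′⊆ : Act′ ⊆ Low ++ High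
    Act′⊆ p = subst (_ ∈_) X++Act′ (∈-++⁺ʳ X p)
    uniq : Unique (X ++ Act′)
    uniq = subst Unique (sym X++Act′) (unique-++⁺ (Unique.filter⁺ bottom? rest-uniq) (Unique.filter⁺ (¬? ∘ bottom?) rest-uniq)
      λ p s → proj₂ (∈-filter⁻ (¬? ∘ bottom?) {xs = Rest} s) (proj₂ (∈-filter⁻ bottom? {xs = Rest} p)))
    W = Σ[ weight A ]
    Old′ = Old ++ New
    |Old′| : length Old′ ≡ length Old + length New
    |Old′| = length-++ Old
    few-old′ : length Old′ < K
    few-old′ = subst (_< K) (sym |Old′|) (≰⇒> K≰)
    pot : goal r + D * q ^ ℓ ≤ W Rest + length Old′ * q ^ m
    pot = begin
      goal r + D * q ^ ℓ                                      ≤⟨ potential ⟩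
      W Act + length Old * q ^ m                              ≡⟨ cong (_+ length Old * q ^ m) (Σ-filter (weight A) done? Act) ⟩
      W New + W Rest + length Old * q ^ m                     ≤⟨ +-monoˡ-≤ _ (+-monoˡ-≤ _ (Σ-upper New λ {u} _ → weight≤ A u)) ⟩
      length New * q ^ m + W Rest + length Old * q ^ m        ≡⟨ solve 4 (λ x w o p → x :* p :+ w :+ o :* p := w :+ (o :+ x) :* p) refl (length New) (W Rest) (length Old) (q ^ m) ⟩
      W Rest + (length Old + length New) * q ^ m              ≡⟨ cong (λ l → W Rest + l * q ^ m) (sym |Old′|) ⟩
      W Rest + length Old′ * q ^ m                            ∎
    many-rest : reserve * q ≤ length Rest
    many-rest = many-active {A} {r} Rest (length Old′) few-old′ (proj₂ ∘ rest) (≤-trans (m≤m+n _ _) pot)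
    length-parts : length Rest ≡ length (Low ++ High)
    length-parts = trans (length-filter-¬ bottom? Rest) (sym (length-++ Low))
    D≤ : D ≤ length (Low ++ High)
    D≤ = begin
      D                        ≤⟨ n≤1+n D ⟩
      q                        ≤⟨ m≤m+n q _ ⟩
      reserve * q              ≤⟨ many-rest ⟩
      length Rest              ≡⟨ length-parts ⟩
      length (Low ++ High)     ∎
    |X| : length X ≡ D
    |X| = trans (length-take D (Low ++ High)) (m≤n⇒m⊓n≡m D≤)
    W-parts : W Rest ≡ W X + W Act′
    W-parts = trans (Σ-filter (weight A) bottom? Rest) (trans (sym (Σ-++ (weight A) Low High))
      (trans (cong W (sym X++Act′)) (Σ-++ (weight A) X Act′)))
    Act′-uniq = unique-++⁻ʳ X uniq
    few-act′ : length Act′ ≤ h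
    few-act′ = ≤-trans (length-⊆ Act′-uniq (proj₁ ∘ rest ∘ low-high ∘ Act′⊆)) few-act
    open Discard {F} {A} X Act′ uniq few-act′ |X| (proj₂ ∘ rest ∘ low-high ∘ X⊆) (covered ∘ proj₁ ∘ rest ∘ low-high ∘ X⊆)
    kill = split-filter touches? F
    old′ : ∀ {x} → x ∈ Old′ → m ≤ deg A x
    old′ {x} p with ∈-++⁻ Old p
    ... | inj₁ s = ≤-trans (old s) (deg-mono {L = A₀} x grown)
    ... | inj₂ s = proj₂ (∈-filter⁻ done? {xs = Act} s)
    old-uniq′ : Unique Old′
    old-uniq′ = unique-++⁺ old-uniq (Unique.filter⁺ done? act-uniq) λ p s → <⇒≱ (act (proj₁ (∈-filter⁻ done? {xs = Act} s))) (old p)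
    move : ∀ ℓ′ r′ → ℓ′ + r′ ≡ m → (∀ {u} → u ∈ Act′ → ℓ′ ≤ deg A u) → goal r′ ≤ W Act′ + length Old′ * q ^ m → EnfWinsE H b F A
    move ℓ′ r′ lv low′ pot′ = enforcer-move H b kill enough-killed
      (≤-trans (≤-trans (*-mono-≤ 0<D 0<h) enough-killed) (≤-trans (m≤m+n _ (length kept)) (≤-reflexive (split-length kill))))
      (continue (≤-trans (m≤n+m _ (length killed)) (≤-reflexive (split-length kill))) record
        { Act = Act′ ; Old = Old′ ; ℓ = ℓ′ ; r = r′ ; levels = lv
        ; board = board-discard kill board
        ; act-uniq = Act′-uniq ; old-uniq = old-uniq′
        ; low = low′ ; act = proj₂ ∘ rest ∘ low-high ∘ Act′⊆ ; old = old′
        ; few-old = few-old′ ; few-act = few-act′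
        ; covered = λ u∈ → covered-kept u∈ (covered (proj₁ (rest (low-high (Act′⊆ u∈)))))
        ; touching = λ p → proj₂ (∈-filter⁻ touches? {xs = F} p)
        ; potential = pot′ })
    after : ∀ {c} r′ → goal r′ + c ≤ W Rest + length Old′ * q ^ m → W X ≤ c → goal r′ ≤ W Act′ + length Old′ * q ^ m
    after {c} r′ le WX = +-cancelʳ-≤ c _ _ (begin
      goal r′ + c                                   ≤⟨ le ⟩
      W Rest + length Old′ * q ^ m                  ≡⟨ cong (_+ length Old′ * q ^ m) W-parts ⟩
      W X + W Act′ + length Old′ * q ^ m            ≤⟨ +-monoˡ-≤ _ (+-monoˡ-≤ _ WX) ⟩
      c + W Act′ + length Old′ * q ^ m              ≡⟨ solve 3 (λ c w o → c :+ w :+ o := w :+ o :+ c) refl c (W Act′) (length Old′ * q ^ m) ⟩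
      W Act′ + length Old′ * q ^ m + c              ∎)
    discard : ∀ r′ → ℓ + r′ ≡ m → goal r′ + D * q ^ ℓ ≤ W Rest + length Old′ * q ^ m → EnfWinsE H b F A
    discard r′ lv le with D ≤? length Low
    ... | yes D≤Low = move ℓ r′ lv (λ u∈ → low (proj₁ (rest (low-high (Act′⊆ u∈))))) (after r′ le (begin
        W X                ≤⟨ Σ-upper X (λ p → weight-below {A} (proj₂ (∈-filter⁻ bottom? {xs = Rest} (take-++-⊆ D Low D≤Low p)))) ⟩
        length X * q ^ ℓ   ≡⟨ cong (_* q ^ ℓ) |X| ⟩
        D * q ^ ℓ          ∎))
    -- Here `ℓ` equals `m`, but the vertices of `Rest` have degree at least `ℓ` and below `m`.
    discard zero lv le | no D≰ = ⊥-elim (empty Rest refl)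
      where
      empty : ∀ zs → Rest ≡ zs → ⊥
      empty [] eq with () ← ≤-trans (≤-trans 0<D D≤) (≤-reflexive (trans (sym length-parts) (cong length eq)))
      empty (z ∷ zs) eq = let (z∈ , lt) = rest (subst (z ∈_) (sym eq) (here refl)) in
        <⇒≱ lt (≤-trans (≤-reflexive (trans (sym lv) (+-identityʳ ℓ))) (low z∈))
    -- Lowering `r` by one frees `q ^ m`, which pays for `D` vertices of weight at most `q ^ m′`
    -- each.
    discard (suc r′) lv le | no D≰ = move (suc ℓ) r′ (trans (sym (+-suc ℓ r′)) lv)
      (λ u∈ → ≰⇒> (proj₂ (∈-filter⁻ (¬? ∘ bottom?) {xs = Rest} (drop-++-⊆ D Low (<⇒≤ (≰⇒> D≰)) u∈))))
      (after r′ (begin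
        goal r′ + q ^ m          ≡⟨ solve 3 (λ e r p → (e :+ r) :* p :+ p := (e :+ (con 1 :+ r)) :* p) refl (K + reserve) r′ (q ^ m) ⟩
        goal (suc r′)            ≤⟨ m≤m+n _ (D * q ^ ℓ) ⟩
        goal (suc r′) + D * q ^ ℓ ≤⟨ le ⟩
        W Rest + length Old′ * q ^ m ∎) (begin
        W X                      ≤⟨ Σ-upper X (λ p → weight-below {A} (s≤s⁻¹ (proj₂ (rest (low-high (X⊆ p)))))) ⟩
        length X * q ^ m′        ≡⟨ cong (_* q ^ m′) |X| ⟩
        D * q ^ m′               ≤⟨ *-monoˡ-≤ (q ^ m′) (n≤1+n D) ⟩
        q ^ m                    ∎))

  play : ∀ fuel {F A} → length F ≤ fuel → Position F A → EnfWinsA H b F A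
  -- With no edge free, a covered active vertex would have degree `n - 1` in `A`, whereas active
  -- degrees are below `m < n`.
  play fuel {[]} {A} _ pos = ⊥-elim (nonempty Act refl)
    where
    open Position pos
    nonempty : ∀ zs → Act ≡ zs → ⊥
    nonempty [] eq with () ← ≤-trans (many-active {A} {r} Act (length Old) few-old act potential) (≤-reflexive (cong length eq))
    nonempty (z ∷ zs) eq = <⇒≱ m<n (≤-trans (covered-[] {A = A} (covered z∈)) (act z∈))
      where z∈ = subst (z ∈_) (sym eq) (here refl)
  play (suc fuel) {e ∷ F} (s≤s le) pos = moveA λ {S} {R} s 1≤S → respond (after-avoider pos s 1≤S) λ R′≤R pos′ →
    play fuel (≤-trans R′≤R (s≤s⁻¹ (≤-trans (+-monoˡ-≤ (length R) 1≤S) (≤-trans (≤-reflexive (split-length s)) (s≤s le))))) pos′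

  enforcer-wins : (K + reserve + m + 1) * q ^ m ≤ h → EnforcerWins H n b
  enforcer-wins large = launch (edgesK n) refl
    where
    open ≤-Reasoning
    Act₀ = take h (allFin n)
    |Act₀| : length Act₀ ≡ h
    |Act₀| = trans (length-take h (allFin n)) (m≤n⇒m⊓n≡m (≤-trans (m≤m+n h _) (≤-trans 4h≤n (≤-reflexive (sym length-allFin)))))
    q≤q^m : q ≤ q ^ m
    q≤q^m = ≤-trans (≤-reflexive (sym (*-identityʳ q))) (*-monoʳ-≤ q (m^n>0 q m′))
    -- Avoider's first move needs separate treatment, because the edges outside `Act₀` are still
    -- free and `touching` need not hold. The summand 1 in `large` provides the term `D * q ^ 0` of
    -- a `Response`.
    opening : ∀ {S R} → Split (edgesK n) S R → Response R [] (S ++ [])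
    opening {S} {R} s = record
      { Act = Act₀ ; Old = [] ; ℓ = 0 ; r = m ; levels = refl
      ; board = board-claim s board-initial ; grown = λ ()
      ; act-uniq = Unique.take⁺ h (Unique.allFin⁺ n) ; old-uniq = []
      ; low = λ _ → z≤n ; act = λ {u} _ → ≤-trans (s≤s (≤-reflexive (deg-[] u))) (s≤s z≤n) ; old = λ ()
      ; few-old = s≤s z≤n ; few-act = ≤-reflexive |Act₀|
      ; many-act = begin
          reserve * q                           ≤⟨ *-mono-≤ (≤-trans (m≤n+m reserve K) (≤-trans (m≤m+n _ m) (m≤m+n _ 1))) q≤q^m ⟩
          (K + reserve + m + 1) * q ^ m         ≤⟨ large ⟩
          h                                     ≡⟨ sym |Act₀| ⟩
          length Act₀                           ∎
      ; covered = λ {u} _ → covered-claim {A = []} s (covered-initial u)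
      ; potential = begin
          goal m + D * 1                        ≡⟨ cong (goal m +_) (*-identityʳ D) ⟩
          goal m + D                            ≤⟨ +-monoʳ-≤ (goal m) (≤-trans (n≤1+n D) q≤q^m) ⟩
          goal m + q ^ m                        ≡⟨ trans (+-comm (goal m) _) (cong (_* q ^ m) (+-comm 1 (K + reserve + m))) ⟩
          (K + reserve + m + 1) * q ^ m         ≤⟨ large ⟩
          h                                     ≡⟨ trans (sym |Act₀|) (sym (*-identityʳ _)) ⟩
          length Act₀ * 1                       ≤⟨ Σ-lower Act₀ (λ {u} _ → m^n>0 q (m ⊓ deg (S ++ []) u)) ⟩
          Σ[ weight (S ++ []) ] Act₀            ≤⟨ m≤m+n _ 0 ⟩
          Σ[ weight (S ++ []) ] Act₀ + 0        ∎
      }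
    launch : ∀ F → edgesK n ≡ F → EnfWinsA H b (edgesK n) []
    launch [] eq = ⊥-elim (nonempty Act₀ refl)
      where
      nonempty : ∀ zs → Act₀ ≡ zs → ⊥
      nonempty [] e with () ← ≤-trans 0<h (≤-trans (≤-reflexive (sym |Act₀|)) (≤-reflexive (cong length e)))
      nonempty (z ∷ _) _ = <⇒≱ m<n (≤-trans (covered-[] {A = []} (subst (λ F → Covered F [] z) eq (covered-initial z))) (≤-trans (≤-reflexive (cong suc (deg-[] z))) (s≤s z≤n)))
    launch (e ∷ F) eq = subst (λ G → EnfWinsA H b G []) (sym eq) (moveA λ {S} {R} s 1≤S →
      respond (opening (subst (λ G → Split G S R) (sym eq) s)) λ _ pos → play _ ≤-refl pos)

-- The two thresholds

^-distribʳ-* : ∀ m x y → (x * y) ^ m ≡ x ^ m * y ^ m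
^-distribʳ-* zero x y = refl
^-distribʳ-* (suc m) x y = trans (cong (x * y *_) (^-distribʳ-* m x y))
  (solve 4 (λ x y p q → x :* y :* (p :* q) := x :* p :* (y :* q)) refl x y (x ^ m) (y ^ m))
  where open +-*-Solver

m≤m^suc : ∀ x j → x ≤ x ^ suc j
m≤m^suc zero j = z≤n
m≤m^suc (suc x) j = ≤-trans (≤-reflexive (sym (*-identityʳ (suc x)))) (*-monoʳ-≤ (suc x) (m^n>0 (suc x) j))

-- With `h` of order `n` and `D` of order `h ^ (1 / m)`, the bias `D * h` has order
-- `n ^ (1 + 1 / m)`.
lower-bound : ∀ m Q n h D → n ≤ 8 * h → 0 < D → h < Q * (2 + D) ^ m →
              n ^ suc m ≤ 8 * Q * (3 ^ m * 8 ^ m) * (D * h) ^ m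
lower-bound m Q n h D n≤8h 0<D tight = begin
    n * n ^ m                                     ≤⟨ *-mono-≤ n≤8h (^-monoˡ-≤ m n≤8h) ⟩
    8 * h * (8 * h) ^ m                           ≤⟨ *-monoˡ-≤ _ (*-monoʳ-≤ 8 (≤-trans (<⇒≤ tight) (*-monoʳ-≤ Q (^-monoˡ-≤ m 2+D≤3D)))) ⟩
    8 * (Q * (3 * D) ^ m) * (8 * h) ^ m           ≡⟨ cong₂ (λ x y → 8 * (Q * x) * y) (^-distribʳ-* m 3 D) (^-distribʳ-* m 8 h) ⟩
    8 * (Q * (3 ^ m * D ^ m)) * (8 ^ m * h ^ m)   ≡⟨ solve 5 (λ q x y z w → con 8 :* (q :* (x :* y)) :* (z :* w) := con 8 :* q :* (x :* z) :* (y :* w)) refl Q (3 ^ m) (D ^ m) (8 ^ m) (h ^ m) ⟩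
    8 * Q * (3 ^ m * 8 ^ m) * (D ^ m * h ^ m)     ≡⟨ cong (8 * Q * (3 ^ m * 8 ^ m) *_) (sym (^-distribʳ-* m D h)) ⟩
    8 * Q * (3 ^ m * 8 ^ m) * (D * h) ^ m         ∎
  where
  open ≤-Reasoning
  open +-*-Solver
  2+D≤3D : 2 + D ≤ 3 * D
  2+D≤3D = ≤-trans (+-monoˡ-≤ D (*-monoʳ-≤ 2 0<D)) (≤-reflexive (solve 1 (λ d → con 2 :* d :+ d := con 3 :* d) refl D))

-- Makes `suc D`, for `D = suc i`, the integer `m`-th root of `h / Q`. The search starts at 2, so
-- that `D` is positive.
root : ∀ j Q h (let m = suc j) → 0 < Q → Q * 2 ^ m ≤ h → ∃ λ i → Q * (2 + i) ^ m ≤ h × h < Q * (3 + i) ^ m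
root j Q h 0<Q base =
  let (i , fits , tight) = last-true (λ i → Q * (2 + i) ^ suc j ≤? h) base h (<⇒≱ (begin-strict
        h                     <⟨ m<n+m h {2} (s≤s z≤n) ⟩
        2 + h                 ≤⟨ m≤m^suc (2 + h) j ⟩
        (2 + h) ^ suc j       ≤⟨ m≤n*m _ Q {{>-nonZero 0<Q}} ⟩
        Q * (2 + h) ^ suc j   ∎))
  in i , fits , ≰⇒> tight
  where open ≤-Reasoning

quarter : ∀ P n → 0 < P → 4 * P ≤ n → ∃ λ h → 4 * h ≤ n × n ≤ 8 * h × P ≤ h
quarter P n 0<P N≤n = h , ≤-trans (≤-reflexive (*-comm 4 h)) (m/n*n≤m n 4) , n≤8h , base
  where
  open ≤-Reasoning
  open +-*-Solver
  h = n / 4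
  base : P ≤ h
  base = ≤-trans (≤-reflexive (sym (m*n/n≡m P 4))) (/-monoˡ-≤ 4 (≤-trans (≤-reflexive (*-comm P 4)) N≤n))
  n≤8h : n ≤ 8 * h
  n≤8h = begin
    n                    ≡⟨ m≡m%n+[m/n]*n n 4 ⟩
    n % 4 + h * 4        ≤⟨ +-monoˡ-≤ (h * 4) (<⇒≤ (m%n<n n 4)) ⟩
    4 + h * 4            ≤⟨ +-monoˡ-≤ (h * 4) (*-monoʳ-≤ 4 (≤-trans 0<P base)) ⟩
    4 * h + h * 4        ≡⟨ solve 1 (λ h → con 4 :* h :+ h :* con 4 := con 8 :* h) refl h ⟩
    8 * h                ∎

-- The bias `b` is won and `suc (c * X)` is not, so a threshold `t` exists. It is at least `b`, and
-- `upper` applies to `t` because `t` itself is won.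
sandwich : ∀ H → WellFormed H → ∀ {n} j C c X b (let m = suc j) →
           (∀ {b} → EnforcerWins H n b → b ^ m ≤ c * X) → EnforcerWins H n b → X ≤ C * b ^ m →
           ∃ λ t → IsMonThreshold H n t × (X ≤ (C + c) * t ^ m) × (t ^ m ≤ (C + c) * X)
sandwich H wf {n} j C c X b upper wins lower =
  let (t , isT) = threshold-exists H wf n {b} {suc (c * X)} wins (λ w → <⇒≱ (m≤m^suc (suc (c * X)) j) (upper w))
      b≤t = Equivalence.to (isT b) wins
  in t , isT ,
     ≤-trans lower (*-mono-≤ (m≤m+n C c) (^-monoˡ-≤ (suc j) b≤t)) ,
     ≤-trans (upper (Equivalence.from (isT t) ≤-refl)) (*-monoˡ-≤ X (m≤n+m c C))

module Theta (H : Graph) (k m′ : ℕ) (wf : WellFormed H)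
  (safe : ∀ {n} (A : List (Edge n)) e → (∀ x → deg A x < suc m′) → ¬ ContainsCopy H (e ∷ A))
  (link-wins : ∀ {n h} → 4 * h ≤ n → suc k < h → ∀ {F G : List (Edge n)} {u x} →
               Stars G (suc m′) u x → Covered F G u → WonByEdge H F G)
  (hub-wins : ∀ {n h} → 4 * h ≤ n → suc k < h → ∀ {F G : List (Edge n)} → Hub F G (suc k) h → ContainsCopy H G)
  where

  m : ℕ
  m = suc m′

  Q : ℕ
  Q = enough m + 3 * suc k + m + 1

  C₀ : ℕ
  C₀ = 8 * Q * (3 ^ m * 8 ^ m)

  0<Q : 0 < Q
  0<Q = s≤s z≤n

  -- From here on a quarter of `n` is at least `Q * 2 ^ m`, the starting value of `root`.
  N₀ : ℕ
  N₀ = 4 * (Q * 2 ^ m)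

  enforcer-at : ∀ {n h D} → 4 * h ≤ n → 0 < D → Q * suc D ^ m ≤ h → EnforcerWins H n (D * h)
  enforcer-at {n} {h} {D} 4h≤n 0<D fits =
      Enforcer.enforcer-wins H k m′ D h 4h≤n m<h k<h 0<D (link-wins 4h≤n k<h) (hub-wins 4h≤n k<h) fits
    where
    open ≤-Reasoning
    Q≤h : Q ≤ h
    Q≤h = ≤-trans (m≤m*n Q (suc D ^ m) {{m^n≢0 (suc D) m}}) fits
    m<h : m < h
    m<h = ≤-trans (≤-trans (≤-reflexive (+-comm 1 m)) (+-monoˡ-≤ 1 (m≤n+m m (enough m + 3 * suc k)))) Q≤h
    k<h : suc k < h
    k<h = begin-strict
      suc k                               ≤⟨ m≤m+n (suc k) (2 * suc k) ⟩
      3 * suc k                           ≤⟨ m≤n+m (3 * suc k) (enough m) ⟩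
      enough m + 3 * suc k                ≤⟨ m≤m+n (enough m + 3 * suc k) m ⟩
      enough m + 3 * suc k + m            <⟨ m<m+n (enough m + 3 * suc k + m) (s≤s z≤n) ⟩
      Q                                   ≤⟨ Q≤h ⟩
      h                                   ∎

  enforcer-lower : ∀ n → N₀ ≤ n → ∃ λ b → EnforcerWins H n b × n ^ suc m ≤ C₀ * b ^ m
  enforcer-lower n N≤n =
    let (h , 4h≤n , n≤8h , base) = quarter (Q * 2 ^ m) n (*-mono-≤ 0<Q (m^n>0 2 m)) N≤n
        (i , fits , tight) = root m′ Q h 0<Q base
    in suc i * h , enforcer-at {n} {h} {suc i} 4h≤n (s≤s z≤n) fits , lower-bound m Q n h (suc i) n≤8h (s≤s z≤n) tight

  avoider-upper : ∀ {n b} → EnforcerWins H n b → b ^ m ≤ 4 ^ m * n ^ suc m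
  avoider-upper {n} {b} w = ≮⇒≥ λ lt → Avoider.avoider-wins b H m lt safe w

  threshold : ∃ λ C → ∃ λ N → ∀ n → N ≤ n → ∃ λ t →
              IsMonThreshold H n t × (n ^ suc m ≤ C * t ^ m) × (t ^ m ≤ C * n ^ suc m)
  threshold = C₀ + 4 ^ m , N₀ , λ n N≤n →
    let (b , wins , lower) = enforcer-lower n N≤n
    in sandwich H wf {n} m′ C₀ (4 ^ m) (n ^ suc m) b avoider-upper wins lower

module _ {n h k : ℕ} (4h≤n : 4 * h ≤ n) (k<h : suc k < h) where
  open ≤-Reasoning
  open +-*-Solver

  two-stars-fit : suc k + suc k < n
  two-stars-fit = begin-strict
    suc k + suc k       <⟨ +-mono-< k<h k<h ⟩
    h + h               ≤⟨ m≤m+n (h + h) (h + h) ⟩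
    h + h + (h + h)     ≡⟨ solve 1 (λ h → h :+ h :+ (h :+ h) := con 4 :* h) refl h ⟩
    4 * h               ≤⟨ 4h≤n ⟩
    n                   ∎

  hub-fits : suc (h + suc (suc k)) + k ≤ n
  hub-fits = begin
    suc (h + suc (suc k)) + k     ≡⟨ solve 2 (λ h k → con 1 :+ (h :+ (con 2 :+ k)) :+ k := h :+ (con 2 :+ k) :+ (con 1 :+ k)) refl h k ⟩
    h + suc (suc k) + suc k       ≤⟨ +-mono-≤ (+-monoʳ-≤ h k<h) (<⇒≤ k<h) ⟩
    h + h + h                     ≤⟨ m≤m+n (h + h + h) h ⟩
    h + h + h + h                 ≡⟨ solve 1 (λ h → h :+ h :+ h :+ h := con 4 :* h) refl h ⟩
    4 * h                         ≤⟨ 4h≤n ⟩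
    n                             ∎

-- Here `m = k - 1`: stars with `k - 1` leaves only lack the edge between their centres.
doubleStar-threshold : ∀ j (let k = suc (suc j)) → ∃ λ C → ∃ λ N → ∀ n → N ≤ n → ∃ λ t →
  IsMonThreshold (doubleStar k) n t × (n ^ k ≤ C * t ^ (k ∸ 1)) × (t ^ (k ∸ 1) ≤ C * n ^ k)
doubleStar-threshold j = Theta.threshold (doubleStar (suc (suc j))) (suc j) j (doubleStar-wf (suc j))
  (doubleStar-safe (suc j))
  (λ 4h≤n k<h → doubleStar-link (two-stars-fit 4h≤n k<h))
  (λ {n} {h} 4h≤n k<h → doubleStar-hub (≤-trans (+-monoˡ-≤ (suc j) (s≤s (+-monoʳ-≤ h (n≤1+n _)))) (hub-fits 4h≤n k<h)))

-- Here `m = k`: a star with `k` leaves also supplies the middle vertex.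
pathDoubleStar-threshold : ∀ j (let k = suc (suc j)) → ∃ λ C → ∃ λ N → ∀ n → N ≤ n → ∃ λ t →
  IsMonThreshold (pathDoubleStar k) n t × (n ^ suc k ≤ C * t ^ k) × (t ^ k ≤ C * n ^ suc k)
pathDoubleStar-threshold j = Theta.threshold (pathDoubleStar (suc (suc j))) (suc j) (suc j) (pathDoubleStar-wf (suc j))
  (pathDoubleStar-safe (suc j))
  (λ _ _ → pathDoubleStar-link)
  (λ 4h≤n k<h hub → pathDoubleStar-hub (hub-fits 4h≤n k<h) hub (s≤s z≤n))

-- For fixed `k`, the order of growth is expressed without roots: bounding `t ^ (k - 1)` by `n ^ k`
-- up to constants on both sides amounts to `t` having order `n ^ (k / (k - 1))`, and similarly for
-- the path double star.
theorem2 : (k : ℕ) → 3 ≤ k →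
    (∃ λ C → ∃ λ N → ∀ n → N ≤ n → ∃ λ t →
    IsMonThreshold (doubleStar k) n t ×
    (n ^ k ≤ C * t ^ (k ∸ 1)) × (t ^ (k ∸ 1) ≤ C * n ^ k))
    ×
    (∃ λ C → ∃ λ N → ∀ n → N ≤ n → ∃ λ t →
    IsMonThreshold (pathDoubleStar k) n t ×
    (n ^ (k + 1) ≤ C * t ^ k) × (t ^ k ≤ C * n ^ (k + 1)))
theorem2 (suc zero) (s≤s ())
theorem2 k@(suc (suc j)) _ = doubleStar-threshold j ,
  subst (λ p → ∃ λ C → ∃ λ N → ∀ n → N ≤ n → ∃ λ t →
          IsMonThreshold (pathDoubleStar k) n t × (n ^ p ≤ C * t ^ k) × (t ^ k ≤ C * n ^ p))
        (+-comm 1 k) (pathDoubleStar-threshold j)
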